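{- Let $p>3$ be a prime, let $a\in\mathbb{Z}_p$ with $a\not\equiv 0\pmod p$, and let $\langle a\rangle_p$ be the least nonnegative residue of $a$ modulo $p$. Then $$\sum_{k=1}^{(p-1)/2}\frac{\binom ak\binom{ -1-a}k}k+2\sum_{k=1}^{p-1}\frac{(-1)^{k-1}}k\binom ak\equiv\begin{cases}0\pmod{p^2}&\text{if }\langle a\rangle_p\le \frac{p-1}2,\\ pB_{p-2}(-a)\pmod{p^2}&\text{if }\langle a\rangle_p>\frac{p-1}2,\end{cases}$$ and $$\sum_{k=1}^{p-1}\frac{(-1)^{k-1}}k\binom ak\equiv -\frac{B_{2p-2}(-a)-B_{2p-2}}{2p-2}+2\,\frac{B_{p-1}(-a)-B_{p-1}}{p-1}-\frac{a-\langle a\rangle_p}{2}B_{p-2}(-a)\pmod{p^2}.$$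
   Context: $\mathbb{Z}_p$ denotes the set of rational numbers whose denominator is not divisible by $p$; for $x,y\in\mathbb{Z}_p$, $x\equiv y\pmod{p^m}$ means $x-y\in p^m\mathbb{Z}_p$. For $a\in\mathbb{Z}_p$, $\langle a\rangle_p\in\{0,1,\dots,p-1\}$ is defined by $\langle a\rangle_p\equiv a\pmod p$. For any number $x$ and integer $k\ge0$, $\binom xk=x(x-1)\cdots(x-k+1)/k!$. The Bernoulli numbers are defined by $B_0=1$ and $\sum_{k=0}^{n-1}\binom nkB_k=0$ for $n\ge2$, and the Bernoulli polynomials by $B_n(x)=\sum_{k=0}^n\binom nkB_kx^{n-k}$. -}

module Defs where

open import Data.Nat as ℕ using (ℕ; zero; suc; _!; _≤?_)
open import Data.Nat.Properties using (_!≢0)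
open import Data.Nat.Combinatorics using (_C_)
open import Data.Nat.Divisibility using (_∣_)
open import Data.Integer as ℤ using (ℤ; +_)
open import Data.Rational as ℚ using (ℚ; 0ℚ; 1ℚ; _+_; _*_; _-_; -_; ↧ₙ_)
open import Data.Product using (∃; _×_)
open import Relation.Nullary using (¬_; yes; no)
open import Relation.Binary.PropositionalEquality using (_≡_)

ℕ→ℚ : ℕ → ℚ
ℕ→ℚ n = (+ n) ℚ./ 1

_^_ : ℚ → ℕ → ℚ
x ^ zero  = 1ℚ
x ^ suc n = x * (x ^ n)

InZp : ℕ → ℚ → Set
InZp p x = ¬ (p ∣ ↧ₙ x)

Cong : ℕ → ℕ → ℚ → ℚ → Set
Cong p m x y = ∃ λ z → InZp p z × (x - y ≡ ℕ→ℚ (p ℕ.^ m) * z)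

falling : ℚ → ℕ → ℚ
falling x zero    = 1ℚ
falling x (suc k) = falling x k * (x - ℕ→ℚ k)

binom : ℚ → ℕ → ℚ
binom x k = falling x k * ((+ 1) ℚ./ (k !))
  where instance _ = k !≢0

sum1 : ℕ → (ℕ → ℚ) → ℚ
sum1 zero    f = 0ℚ
sum1 (suc n) f = sum1 n f + f (suc n)

sum0 : ℕ → (ℕ → ℚ) → ℚ
sum0 zero    f = f 0
sum0 (suc n) f = sum0 n f + f (suc n)

recip : ℕ → ℚ
recip zero    = 0ℚ
recip (suc j) = (+ 1) ℚ./ suc j

-- Bernoulli numbers: B_0 = 1 and Σ_{k=0}^{N-1} (N choose k) B_k = 0 for N ≥ 2.
-- bernTable n k = B_k for k ≤ n.  With N = n+2 the recurrence gives
-- B_{n+1} = -(1/(n+2)) Σ_{k=0}^{n} (n+2 choose k) B_k.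
bernTable : ℕ → ℕ → ℚ
bernTable zero    k = 1ℚ
bernTable (suc n) k with k ≤? n
... | yes _ = bernTable n k
... | no  _ = - (((+ 1) ℚ./ suc (suc n)) *
                 sum0 n (λ j → ℕ→ℚ (suc (suc n) C j) * bernTable n j))

B : ℕ → ℚ
B n = bernTable n n

Bpoly : ℕ → ℚ → ℚ
Bpoly n x = sum0 n (λ k → ℕ→ℚ (n C k) * B k * (x ^ (n ℕ.∸ k)))

{-# OPTIONS --safe #-}
-- Write a = x + r with x = p t and b_j = x + j, c_j = 1 / b_j, h = (p - 1) / 2.  Both sums on the
-- left have closed differences in a:
--   b (S(b) - S(b - 1)) = 1 - C(b-1, p-1)   for the alternating sum S,
--   b (F(b) - F(b - 1)) = 2 (C(b-1, h) C(-1-b, h) - 1)   for the sum F of products,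
-- where b C(b-1, p-1) = p C(b, p) and b C(b-1, h) C(-1-b, h) = (-1)^h p C(p-1, h) C(b+h, p).
-- Modulo p, C(x + j, p) is t or t + 1 according as j < p or p ≤ j < 2p, so descending from a to x
-- gives S(a) ≡ Σ c_j - x Σ c_j² and F(a) + 2 S(a) ≡ 2p Σ_{h<j≤r} c_j² modulo p².
-- On the Bernoulli side B_n(x + 1) - B_n(x) = n x^(n-1) makes the same descent: the values at - x
-- drop out because B_k is p-integral for k < 2p - 2, k ≠ p - 1, and vanishes for odd k ≥ 3, and
-- then Fermat's theorem turns the powers of b_j into powers of c_j.
module Submission where

open import Defs
open import Data.Nat as ℕ using (ℕ; zero; suc; _∸_; _≤_; _<_; _>_; z≤n; s≤s; _!)
open import Data.Nat.Primality using (Prime; euclidsLemma; prime⇒irreducible; prime⇒nonTrivial)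
open import Data.Rational using (ℚ; mkℚ; 0ℚ; 1ℚ; _+_; _*_; _-_; -_; _/_; 1/_; ↥_; ↧_; ↧ₙ_; toℚᵘ)
open import Data.Integer as ℤ using (ℤ; +_; -[1+_])
open import Data.Product using (∃; _×_; _,_; proj₁; proj₂)
open import Relation.Nullary using (¬_; Dec; yes; no; contradiction)
open import Relation.Nullary.Decidable using (dec⇒maybe)
import Data.Nat.Properties as ℕ
import Data.Nat.DivMod as ℕ
import Data.Nat.Divisibility as ℕ
open import Data.Nat.Divisibility using (_∣_; divides)
open import Data.Nat.Combinatorics using (_C_; nCk≡n!/k![n-k]!; k![n∸k]!∣n!; nCk+nC[k+1]≡[n+1]C[k+1]; nCn≡1; k>n⇒nCk≡0; nC1≡n; nCk≡nC[n∸k])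
import Data.Nat.Coprimality as Coprimality
import Data.Integer.Properties as ℤ
import Data.Rational as ℚ
import Data.Rational.Properties as ℚ
open import Data.Rational.Unnormalised as ℚᵘ using (mkℚᵘ; *≡*)
import Data.Rational.Unnormalised.Properties as ℚᵘ
open import Data.Sum using (_⊎_; inj₁; inj₂; [_,_]′)
open import Level using (0ℓ)
open import Relation.Binary using (Setoid; tri<; tri≈; tri>)
open import Relation.Binary.PropositionalEquality
import Relation.Binary.Reasoning.Setoid as SetoidReasoning
open import Tactic.RingSolver.Core.AlmostCommutativeRing using (AlmostCommutativeRing; fromCommutativeRing)
open import Tactic.RingSolver using (solve-∀)

-- The descent stops at x, where both sums must vanish modulo p². There C(x, k) ≡ (-1)^(k-1) x / k,
-- so S(x) ≡ x Σ 1/k² over k < p and F(x) ≡ - x Σ 1/k² over k ≤ h, and each harmonic sum must supply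
-- a second factor p. The full sum gets it from the Bernoulli side: B_(p-2) is divisible by p at - x
-- and at - (x + p), and the two values differ, up to a unit and a multiple of p, by a sum of
-- (p-3)-rd powers, hence of inverse squares. Reflecting j to p - j passes to the half sum. The half
-- sum also explains the case h < r: modulo p the range h < j ≤ r may start at 1, and that longer
-- sum is what B_(p-2)(-a) measures. The obstacle on the Bernoulli side is B_(p-1), of which only p
-- B_(p-1) is integral. In B_(2p-2)(-x) it comes with x^(p-1), and one factor x pays for the p. The
-- linear coefficients of B_(p-1)(x) and B_(2p-2)(x) are multiples of B_(p-2) and B_(2p-3); these
-- must vanish, since a linear term would contribute only one factor p. The mix of indices 2p - 2
-- and p - 1 is a Newton step: if F ≡ 1 modulo p, then 2F - F² ≡ 1 modulo p².

ringℚ : AlmostCommutativeRing 0ℓ 0ℓ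
ringℚ = fromCommutativeRing ℚ.+-*-commutativeRing λ x → dec⇒maybe (0ℚ ℚ.≟ x)

-- Integers inside the rationals

private
  ι : ℕ → ℚ
  ι = ℕ→ℚ

fromℤ : ℤ → ℚ
fromℤ i = i / 1

-- `_/_` normalises by a gcd and does not compute on variables, so identities between fractions are
-- checked in the unnormalised rationals and carried back by injectivity of `toℚᵘ`.
toℚᵘ-fromℤ : ∀ i → toℚᵘ (fromℤ i) ℚᵘ.≃ mkℚᵘ i 0
toℚᵘ-fromℤ i = ℚ.toℚᵘ-fromℚᵘ (mkℚᵘ i 0)

fromℤ-+ : ∀ i j → fromℤ (i ℤ.+ j) ≡ fromℤ i + fromℤ j
fromℤ-+ i j = ℚ.toℚᵘ-injective (begin
  toℚᵘ (fromℤ (i ℤ.+ j))               ≈⟨ toℚᵘ-fromℤ (i ℤ.+ j) ⟩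
  mkℚᵘ (i ℤ.+ j) 0                     ≈⟨ *≡* (cong (ℤ._* ℤ.1ℤ) (cong₂ ℤ._+_ (sym (ℤ.*-identityʳ i)) (sym (ℤ.*-identityʳ j)))) ⟩
  mkℚᵘ i 0 ℚᵘ.+ mkℚᵘ j 0               ≈⟨ ℚᵘ.+-cong (toℚᵘ-fromℤ i) (toℚᵘ-fromℤ j) ⟨
  toℚᵘ (fromℤ i) ℚᵘ.+ toℚᵘ (fromℤ j)   ≈⟨ ℚ.toℚᵘ-homo-+ (fromℤ i) (fromℤ j) ⟨
  toℚᵘ (fromℤ i + fromℤ j)             ∎)
  where open ℚᵘ.≃-Reasoning

fromℤ-* : ∀ i j → fromℤ (i ℤ.* j) ≡ fromℤ i * fromℤ j
fromℤ-* i j = ℚ.toℚᵘ-injective (begin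
  toℚᵘ (fromℤ (i ℤ.* j))               ≈⟨ toℚᵘ-fromℤ (i ℤ.* j) ⟩
  mkℚᵘ i 0 ℚᵘ.* mkℚᵘ j 0               ≈⟨ ℚᵘ.*-cong (toℚᵘ-fromℤ i) (toℚᵘ-fromℤ j) ⟨
  toℚᵘ (fromℤ i) ℚᵘ.* toℚᵘ (fromℤ j)   ≈⟨ ℚ.toℚᵘ-homo-* (fromℤ i) (fromℤ j) ⟨
  toℚᵘ (fromℤ i * fromℤ j)             ∎)
  where open ℚᵘ.≃-Reasoning

fromℤ-injective : ∀ {i j} → fromℤ i ≡ fromℤ j → i ≡ j
fromℤ-injective {i} {j} eq
  with ℚᵘ.≃-trans (ℚᵘ.≃-sym (toℚᵘ-fromℤ i)) (ℚᵘ.≃-trans (ℚ.toℚᵘ-cong eq) (toℚᵘ-fromℤ j))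
... | *≡* e = trans (sym (ℤ.*-identityʳ i)) (trans e (ℤ.*-identityʳ j))

x*↧x≡↥x : ∀ x → x * ι (↧ₙ x) ≡ fromℤ (↥ x)
x*↧x≡↥x x@(mkℚ n d-1 _) = ℚ.toℚᵘ-injective (begin
  toℚᵘ (x * ι (↧ₙ x))                ≈⟨ ℚ.toℚᵘ-homo-* x (ι (↧ₙ x)) ⟩
  toℚᵘ x ℚᵘ.* toℚᵘ (ι (suc d-1))     ≈⟨ ℚᵘ.*-congˡ {toℚᵘ x} (toℚᵘ-fromℤ (+ suc d-1)) ⟩
  mkℚᵘ n d-1 ℚᵘ.* mkℚᵘ (+ suc d-1) 0 ≈⟨ *≡* (trans (ℤ.*-identityʳ _) (cong (λ k → n ℤ.* (+ suc k)) (sym (ℕ.*-identityʳ d-1)))) ⟩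
  mkℚᵘ n 0                           ≈⟨ toℚᵘ-fromℤ n ⟨
  toℚᵘ (fromℤ n)                     ∎)
  where open ℚᵘ.≃-Reasoning

ι-+ : ∀ m n → ι (m ℕ.+ n) ≡ ι m + ι n
ι-+ m n = trans (cong fromℤ (ℤ.pos-+ m n)) (fromℤ-+ (+ m) (+ n))

ι-* : ∀ m n → ι (m ℕ.* n) ≡ ι m * ι n
ι-* m n = trans (cong fromℤ (ℤ.pos-* m n)) (fromℤ-* (+ m) (+ n))

ι-suc : ∀ n → ι (suc n) ≡ ι n + 1ℚ
ι-suc n = trans (ι-+ 1 n) (ℚ.+-comm 1ℚ (ι n))

recip-inverseʳ : ∀ n → ι (suc n) * recip (suc n) ≡ 1ℚ
recip-inverseʳ n = ℚ.toℚᵘ-injective (begin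
  toℚᵘ (ι (suc n) * recip (suc n))            ≈⟨ ℚ.toℚᵘ-homo-* (ι (suc n)) (recip (suc n)) ⟩
  toℚᵘ (ι (suc n)) ℚᵘ.* toℚᵘ (recip (suc n))  ≈⟨ ℚᵘ.*-cong (toℚᵘ-fromℤ (+ suc n)) (ℚ.toℚᵘ-fromℚᵘ (mkℚᵘ (+ 1) n)) ⟩
  mkℚᵘ (+ suc n) 0 ℚᵘ.* mkℚᵘ (+ 1) n          ≈⟨ *≡* (trans (ℤ.*-identityʳ _) (trans (ℤ.*-identityʳ _) (trans (cong +_ (sym (ℕ.*-identityˡ (suc n)))) (sym (ℤ.*-identityˡ _))))) ⟩
  toℚᵘ 1ℚ                                     ∎)
  where open ℚᵘ.≃-Reasoning

-- An explicit inverse v replaces a nonzero instance, so one cancellation serves reciprocals,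
-- factorials and the units b_j.
*-cancelˡ-inverse : ∀ u {v x y} → u * v ≡ 1ℚ → u * x ≡ u * y → x ≡ y
*-cancelˡ-inverse u {v} {x} {y} uv eq = trans (sym (lemma x)) (trans (cong (_* v) eq) (lemma y))
  where
  rearrange : ∀ u v x → u * x * v ≡ (u * v) * x
  rearrange = solve-∀ ringℚ
  lemma : ∀ x → u * x * v ≡ x
  lemma x = trans (rearrange u v x) (trans (cong (_* x) uv) (ℚ.*-identityˡ x))

ι-cancelˡ : ∀ n {x y} → ι (suc n) * x ≡ ι (suc n) * y → x ≡ y
ι-cancelˡ n = *-cancelˡ-inverse (ι (suc n)) (recip-inverseʳ n)

-- Finite sums and powers

+-interchange : ∀ a b c d → (a + b) + (c + d) ≡ (a + c) + (b + d)
+-interchange = solve-∀ ringℚ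

sum1-+ : ∀ n (f g : ℕ → ℚ) → sum1 n (λ k → f k + g k) ≡ sum1 n f + sum1 n g
sum1-+ zero    f g = refl
sum1-+ (suc n) f g = trans (cong (_+ (f (suc n) + g (suc n))) (sum1-+ n f g))
  (+-interchange (sum1 n f) (sum1 n g) (f (suc n)) (g (suc n)))

sum1-*ˡ : ∀ n c (f : ℕ → ℚ) → sum1 n (λ k → c * f k) ≡ c * sum1 n f
sum1-*ˡ zero    c f = sym (ℚ.*-zeroʳ c)
sum1-*ˡ (suc n) c f = trans (cong (_+ c * f (suc n)) (sum1-*ˡ n c f))
  (sym (ℚ.*-distribˡ-+ c (sum1 n f) (f (suc n))))

-- The last k terms are read from the top. With m = k = h this pairs j with p - j.
sum1-reverse : ∀ m k (f : ℕ → ℚ) →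
  sum1 (m ℕ.+ k) f ≡ sum1 m f + sum1 k (λ i → f (suc (m ℕ.+ k) ∸ i))
sum1-reverse m zero    f = trans (cong (λ n → sum1 n f) (ℕ.+-identityʳ m)) (sym (ℚ.+-identityʳ (sum1 m f)))
sum1-reverse m (suc k) f rewrite ℕ.+-suc m k = begin
  sum1 (suc m ℕ.+ k) f                    ≡⟨ sum1-reverse (suc m) k f ⟩
  sum1 m f + f (suc m) + sum1 k g         ≡⟨ rearrange (sum1 m f) (f (suc m)) (sum1 k g) ⟩
  sum1 m f + (sum1 k g + f (suc m))       ≡⟨ cong (λ i → sum1 m f + (sum1 k g + f i)) (sym (ℕ.m+n∸n≡m (suc m) k)) ⟩
  sum1 m f + (sum1 k g + f (suc m ℕ.+ k ∸ k)) ∎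
  where
  open ≡-Reasoning
  g : ℕ → ℚ
  g i = f (suc (suc m ℕ.+ k) ∸ i)
  rearrange : ∀ a b c → a + b + c ≡ a + (c + b)
  rearrange = solve-∀ ringℚ

1^n≡1 : ∀ n → 1ℚ ^ n ≡ 1ℚ
1^n≡1 zero    = refl
1^n≡1 (suc n) = trans (ℚ.*-identityˡ (1ℚ ^ n)) (1^n≡1 n)

^-+ : ∀ x m n → x ^ (m ℕ.+ n) ≡ (x ^ m) * (x ^ n)
^-+ x zero    n = sym (ℚ.*-identityˡ _)
^-+ x (suc m) n = trans (cong (x *_) (^-+ x m n)) (sym (ℚ.*-assoc x (x ^ m) (x ^ n)))

neg-^-even : ∀ x k → (- x) ^ (k ℕ.+ k) ≡ x ^ (k ℕ.+ k)
neg-^-even x zero    = refl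
neg-^-even x (suc k) rewrite ℕ.+-suc k k =
  trans (rearrange x _) (cong (λ y → x * (x * y)) (neg-^-even x k))
  where
  rearrange : ∀ x y → - x * (- x * y) ≡ x * (x * y)
  rearrange = solve-∀ ringℚ

-- The ring of p-integral rationals and congruences modulo powers of p

module Local (p : ℕ) (p-prime : Prime p) where

  -- A record, unlike InZp, lets x be inferred from a proof of Int x.
  record Int (x : ℚ) : Set where
    constructor mkInt
    field
      p∤↧ : InZp p x

  open Int public

  π : ℚ
  π = ι p

  -- In lowest terms ↧ x is coprime to ↥ x, so it divides every d that clears the denominator; any
  -- such d prime to p is therefore enough.
  Int-intro : ∀ x d i → x * ι d ≡ fromℤ i → ¬ p ∣ d → Int x
  Int-intro x@(mkℚ n d-1 c) d i eq p∤d = mkInt λ p∣↧x → p∤d (ℕ.∣-trans p∣↧x ↧x∣d)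
    where
    open ≡-Reasoning
    rearrange : ∀ a b c → a * b * c ≡ a * c * b
    rearrange = solve-∀ ringℚ
    cross : ↥ x ℤ.* + d ≡ i ℤ.* ↧ x
    cross = fromℤ-injective (begin
      fromℤ (↥ x ℤ.* + d)         ≡⟨ fromℤ-* (↥ x) (+ d) ⟩
      fromℤ (↥ x) * ι d           ≡⟨ cong (_* ι d) (x*↧x≡↥x x) ⟨
      x * ι (↧ₙ x) * ι d          ≡⟨ rearrange x (ι (↧ₙ x)) (ι d) ⟩
      x * ι d * ι (↧ₙ x)          ≡⟨ cong (_* ι (↧ₙ x)) eq ⟩
      fromℤ i * fromℤ (↧ x)       ≡⟨ fromℤ-* i (↧ x) ⟨
      fromℤ (i ℤ.* ↧ x)           ∎)
    ↧x∣d : ↧ₙ x ∣ d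
    ↧x∣d = Coprimality.coprime-divisor {n = ℤ.∣ n ∣}
      (Coprimality.sym (Coprimality.recompute c))
      (divides ℤ.∣ i ∣ (trans (sym (ℤ.abs-* (↥ x) (+ d)))
        (trans (cong ℤ.∣_∣ cross) (ℤ.abs-* i (↧ x)))))

  p∤1 : ¬ p ∣ 1
  p∤1 = ℕ.>⇒∤ (prime>1 p-prime)
    where
    prime>1 : ∀ {p} → Prime p → 1 < p
    prime>1 {p} pr = ℕ.nonTrivial⇒n>1 p {{prime⇒nonTrivial pr}}

  p∤* : ∀ {m n} → ¬ p ∣ m → ¬ p ∣ n → ¬ p ∣ m ℕ.* n
  p∤* {m} {n} p∤m p∤n p∣mn with euclidsLemma m n p-prime p∣mn
  ... | inj₁ p∣m = p∤m p∣m
  ... | inj₂ p∣n = p∤n p∣n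

  Int-fromℤ : ∀ i → Int (fromℤ i)
  Int-fromℤ i = Int-intro (fromℤ i) 1 i (ℚ.*-identityʳ (fromℤ i)) p∤1

  Int-ι : ∀ n → Int (ι n)
  Int-ι n = Int-fromℤ (+ n)

  Int-+ : ∀ {x y} → Int x → Int y → Int (x + y)
  Int-+ {x} {y} Ix Iy = Int-intro (x + y) (↧ₙ x ℕ.* ↧ₙ y) (↥ x ℤ.* ↧ y ℤ.+ ↥ y ℤ.* ↧ x) (begin
    (x + y) * ι (↧ₙ x ℕ.* ↧ₙ y)                     ≡⟨ cong ((x + y) *_) (ι-* (↧ₙ x) (↧ₙ y)) ⟩
    (x + y) * (ι (↧ₙ x) * ι (↧ₙ y))                 ≡⟨ rearrange x y _ _ ⟩
    x * ι (↧ₙ x) * ι (↧ₙ y) + y * ι (↧ₙ y) * ι (↧ₙ x) ≡⟨ cong₂ (λ u v → u * ι (↧ₙ y) + v * ι (↧ₙ x)) (x*↧x≡↥x x) (x*↧x≡↥x y) ⟩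
    fromℤ (↥ x) * fromℤ (↧ y) + fromℤ (↥ y) * fromℤ (↧ x) ≡⟨ cong₂ _+_ (fromℤ-* (↥ x) (↧ y)) (fromℤ-* (↥ y) (↧ x)) ⟨
    fromℤ (↥ x ℤ.* ↧ y) + fromℤ (↥ y ℤ.* ↧ x)       ≡⟨ fromℤ-+ (↥ x ℤ.* ↧ y) (↥ y ℤ.* ↧ x) ⟨
    fromℤ (↥ x ℤ.* ↧ y ℤ.+ ↥ y ℤ.* ↧ x)             ∎) (p∤* (p∤↧ Ix) (p∤↧ Iy))
    where
    open ≡-Reasoning
    rearrange : ∀ x y d e → (x + y) * (d * e) ≡ x * d * e + y * e * d
    rearrange = solve-∀ ringℚ

  Int-* : ∀ {x y} → Int x → Int y → Int (x * y)
  Int-* {x} {y} Ix Iy = Int-intro (x * y) (↧ₙ x ℕ.* ↧ₙ y) (↥ x ℤ.* ↥ y) (begin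
    (x * y) * ι (↧ₙ x ℕ.* ↧ₙ y)         ≡⟨ cong ((x * y) *_) (ι-* (↧ₙ x) (↧ₙ y)) ⟩
    (x * y) * (ι (↧ₙ x) * ι (↧ₙ y))     ≡⟨ rearrange x y _ _ ⟩
    (x * ι (↧ₙ x)) * (y * ι (↧ₙ y))     ≡⟨ cong₂ _*_ (x*↧x≡↥x x) (x*↧x≡↥x y) ⟩
    fromℤ (↥ x) * fromℤ (↥ y)           ≡⟨ fromℤ-* (↥ x) (↥ y) ⟨
    fromℤ (↥ x ℤ.* ↥ y)                 ∎) (p∤* (p∤↧ Ix) (p∤↧ Iy))
    where
    open ≡-Reasoning
    rearrange : ∀ x y d e → (x * y) * (d * e) ≡ (x * d) * (y * e)
    rearrange = solve-∀ ringℚ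

  Int-neg : ∀ {x} → Int x → Int (- x)
  Int-neg {x} Ix = subst Int (-1*x≡-x x) (Int-* (Int-fromℤ (-[1+ 0 ])) Ix)
    where
    -1*x≡-x : ∀ x → - 1ℚ * x ≡ - x
    -1*x≡-x = solve-∀ ringℚ

  Int-- : ∀ {x y} → Int x → Int y → Int (x - y)
  Int-- Ix Iy = Int-+ Ix (Int-neg Iy)

  Int-^ : ∀ {x} n → Int x → Int (x ^ n)
  Int-^ zero    Ix = Int-ι 1
  Int-^ (suc n) Ix = Int-* Ix (Int-^ n Ix)

  Int-recip : ∀ {n} → ¬ p ∣ suc n → Int (recip (suc n))
  Int-recip {n} = Int-intro (recip (suc n)) (suc n) (+ 1)
    (trans (ℚ.*-comm (recip (suc n)) (ι (suc n))) (recip-inverseʳ n))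

  p∤suc : ∀ {n} → suc n < p → ¬ p ∣ suc n
  p∤suc n<p = ℕ.>⇒∤ n<p

  -- Valuation at least m. The quotient is kept as data in the shape of `Cong`, so that the final
  -- congruences are read off directly.
  record V (m : ℕ) (x : ℚ) : Set where
    constructor mkV
    field
      quotient  : ℚ
      integral  : Int quotient
      factorise : x ≡ ι (p ℕ.^ m) * quotient

  V-+ : ∀ {m x y} → V m x → V m y → V m (x + y)
  V-+ {m} (mkV u Iu ex) (mkV v Iv ey) = mkV (u + v) (Int-+ Iu Iv)
    (trans (cong₂ _+_ ex ey) (sym (ℚ.*-distribˡ-+ (ι (p ℕ.^ m)) u v)))

  V-*-V : ∀ {m n x y} → V m x → V n y → V (m ℕ.+ n) (x * y)
  V-*-V {m} {n} (mkV u Iu ex) (mkV v Iv ey) = mkV (u * v) (Int-* Iu Iv)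
    (trans (cong₂ _*_ ex ey) (trans (rearrange (ι (p ℕ.^ m)) u (ι (p ℕ.^ n)) v)
      (cong (_* (u * v)) (trans (sym (ι-* (p ℕ.^ m) (p ℕ.^ n))) (cong ι (sym (ℕ.^-distribˡ-+-* p m n)))))))
    where
    rearrange : ∀ a u b v → (a * u) * (b * v) ≡ (a * b) * (u * v)
    rearrange = solve-∀ ringℚ

  Int⇒V0 : ∀ {x} → Int x → V 0 x
  Int⇒V0 {x} Ix = mkV x Ix (sym (ℚ.*-identityˡ x))

  V⇒Int : ∀ {m x} → V m x → Int x
  V⇒Int {m} (mkV u Iu ex) = subst Int (sym ex) (Int-* (Int-ι (p ℕ.^ m)) Iu)

  V-*ˡ : ∀ {m c x} → Int c → V m x → V m (c * x)
  V-*ˡ Ic = V-*-V (Int⇒V0 Ic)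

  V-*ʳ : ∀ {m x c} → V m x → Int c → V m (x * c)
  V-*ʳ {m} {x} {c} Vx Ic = subst (V m) (ℚ.*-comm c x) (V-*ˡ Ic Vx)

  V-neg : ∀ {m x} → V m x → V m (- x)
  V-neg {m} {x} Vx = subst (V m) (-1*x≡-x x) (V-*ˡ (Int-fromℤ (-[1+ 0 ])) Vx)
    where
    -1*x≡-x : ∀ x → - 1ℚ * x ≡ - x
    -1*x≡-x = solve-∀ ringℚ

  V-0 : ∀ m → V m 0ℚ
  V-0 m = mkV 0ℚ (Int-ι 0) (sym (ℚ.*-zeroʳ (ι (p ℕ.^ m))))

  V-≥ : ∀ {m n x} → n ≤ m → V m x → V n x
  V-≥ {m} {n} {x} n≤m (mkV u Iu ex) = mkV (ι (p ℕ.^ (m ∸ n)) * u) (Int-* (Int-ι (p ℕ.^ (m ∸ n))) Iu)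
    (trans ex (trans (cong (_* u) (trans (cong (λ k → ι (p ℕ.^ k)) (sym (ℕ.m+[n∸m]≡n n≤m)))
      (trans (cong ι (ℕ.^-distribˡ-+-* p n (m ∸ n))) (ι-* (p ℕ.^ n) (p ℕ.^ (m ∸ n)))))) (ℚ.*-assoc (ι (p ℕ.^ n)) (ι (p ℕ.^ (m ∸ n))) u)))

  p^1≡π : ι (p ℕ.^ 1) ≡ π
  p^1≡π = cong ι (ℕ.^-identityʳ p)

  V-π : V 1 π
  V-π = mkV 1ℚ (Int-ι 1) (trans (sym p^1≡π) (sym (ℚ.*-identityʳ (ι (p ℕ.^ 1)))))

  V-∣ : ∀ {n} → p ∣ n → V 1 (ι n)
  V-∣ (divides k refl) = subst (V 1) (sym (ι-* k p)) (V-*ˡ (Int-ι k) V-π)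

  -- Clearing the denominator of the quotient u gives n ↧u = ↥u p, and p does not divide ↧u.
  V1-ι⇒∣ : ∀ {n} → V 1 (ι n) → p ∣ n
  V1-ι⇒∣ {n} (mkV u Iu eq) = [ (λ p∣n → p∣n) , (λ p∣↧u → contradiction p∣↧u (p∤↧ Iu)) ]′
    (euclidsLemma n (↧ₙ u) p-prime (divides ℤ.∣ ↥ u ∣ n*↧u-abs))
    where
    open ≡-Reasoning
    rearrange : ∀ a b c → a * b * c ≡ b * c * a
    rearrange = solve-∀ ringℚ
    n*↧u : + n ℤ.* ↧ u ≡ ↥ u ℤ.* + p
    n*↧u = fromℤ-injective (begin
      fromℤ (+ n ℤ.* ↧ u)          ≡⟨ fromℤ-* (+ n) (↧ u) ⟩
      ι n * ι (↧ₙ u)               ≡⟨ cong (_* ι (↧ₙ u)) eq ⟩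
      ι (p ℕ.^ 1) * u * ι (↧ₙ u)   ≡⟨ cong (λ k → k * u * ι (↧ₙ u)) p^1≡π ⟩
      π * u * ι (↧ₙ u)             ≡⟨ rearrange π u (ι (↧ₙ u)) ⟩
      u * ι (↧ₙ u) * π             ≡⟨ cong (_* π) (x*↧x≡↥x u) ⟩
      fromℤ (↥ u) * π              ≡⟨ fromℤ-* (↥ u) (+ p) ⟨
      fromℤ (↥ u ℤ.* + p)          ∎)
    n*↧u-abs : n ℕ.* ↧ₙ u ≡ ℤ.∣ ↥ u ∣ ℕ.* p
    n*↧u-abs = trans (sym (ℤ.abs-* (+ n) (↧ u))) (trans (cong ℤ.∣_∣ n*↧u) (ℤ.abs-* (↥ u) (+ p)))

  -- The ring is local: if p divided the numerator of x, then x would lie in `V 1`; so |↥ x| is an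
  -- admissible denominator for 1/ x.
  invertible : ∀ x → Int x → ¬ V 1 x → ∃ λ c → Int c × x * c ≡ 1ℚ
  invertible x Ix ¬V = 1/ x , Int-1/ , ℚ.*-inverseʳ x
    where
    x≢0 : x ≢ 0ℚ
    x≢0 refl = ¬V (V-0 1)
    instance
      x-nonZero : ℚ.NonZero x
      x-nonZero = ℚ.≢-nonZero x≢0
    open ≡-Reasoning
    Int-1/ : Int (1/ x)
    Int-1/ = Int-intro (1/ x) ℤ.∣ ↥ x ∣ (sgn (↥ x) ℤ.* ↧ x) (lemma x) p∤↥x
      where
      -- `Int-intro` wants a natural denominator, so the sign of ↥ x has to move into the numerator
      -- of the inverse.
      sgn : ℤ → ℤ
      sgn (+ n)    = + 1
      sgn -[1+ n ] = -[1+ 0 ]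
      sgn-abs : ∀ i → fromℤ i ≡ fromℤ (sgn i) * ι ℤ.∣ i ∣
      sgn-abs i@(+ n)    = sym (ℚ.*-identityˡ (ι n))
      sgn-abs i@(-[1+ n ]) = trans (cong fromℤ (sym (ℤ.-1*i≡-i (+ suc n)))) (fromℤ-* -[1+ 0 ] (+ suc n))
      sgn-sgn : ∀ i → fromℤ (sgn i) * fromℤ (sgn i) ≡ 1ℚ
      sgn-sgn (+ n)    = refl
      sgn-sgn -[1+ n ] = refl
      abs-sgn : ∀ i → ι ℤ.∣ i ∣ ≡ fromℤ (sgn i) * fromℤ i
      abs-sgn i = begin
        ι ℤ.∣ i ∣                                           ≡⟨ ℚ.*-identityˡ _ ⟨
        1ℚ * ι ℤ.∣ i ∣                                      ≡⟨ cong (_* ι ℤ.∣ i ∣) (sgn-sgn i) ⟨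
        fromℤ (sgn i) * fromℤ (sgn i) * ι ℤ.∣ i ∣           ≡⟨ ℚ.*-assoc (fromℤ (sgn i)) _ _ ⟩
        fromℤ (sgn i) * (fromℤ (sgn i) * ι ℤ.∣ i ∣)         ≡⟨ cong (fromℤ (sgn i) *_) (sgn-abs i) ⟨
        fromℤ (sgn i) * fromℤ i                             ∎
      lemma : ∀ x .{{_ : ℚ.NonZero x}} → 1/ x * ι ℤ.∣ ↥ x ∣ ≡ fromℤ (sgn (↥ x) ℤ.* ↧ x)
      lemma x = begin
        1/ x * ι ℤ.∣ ↥ x ∣                          ≡⟨ cong (1/ x *_) (trans (abs-sgn (↥ x)) (cong (fromℤ (sgn (↥ x)) *_) (sym (x*↧x≡↥x x)))) ⟩
        1/ x * (fromℤ (sgn (↥ x)) * (x * ι (↧ₙ x))) ≡⟨ rearrange′ (1/ x) (fromℤ (sgn (↥ x))) x (ι (↧ₙ x)) ⟩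
        x * 1/ x * (fromℤ (sgn (↥ x)) * ι (↧ₙ x))   ≡⟨ cong (_* (fromℤ (sgn (↥ x)) * ι (↧ₙ x))) (ℚ.*-inverseʳ x) ⟩
        1ℚ * (fromℤ (sgn (↥ x)) * ι (↧ₙ x))         ≡⟨ ℚ.*-identityˡ _ ⟩
        fromℤ (sgn (↥ x)) * ι (↧ₙ x)                ≡⟨ fromℤ-* (sgn (↥ x)) (↧ x) ⟨
        fromℤ (sgn (↥ x) ℤ.* ↧ x)                   ∎
        where
        rearrange′ : ∀ a s x d → a * (s * (x * d)) ≡ x * a * (s * d)
        rearrange′ = solve-∀ ringℚ
      p∤↥x : ¬ p ∣ ℤ.∣ ↥ x ∣
      p∤↥x p∣↥x = ¬V (subst (V 1) eq (V-*ʳ (V-*ˡ (Int-fromℤ (sgn (↥ x))) (V-∣ p∣↥x)) (Int-den x Ix)))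
        where
        Int-den : ∀ x → Int x → Int (recip (↧ₙ x))
        Int-den (mkℚ n d-1 c) (mkInt p∤d) = Int-recip {d-1} p∤d
        den-inverse : ∀ x → ι (↧ₙ x) * recip (↧ₙ x) ≡ 1ℚ
        den-inverse (mkℚ n d-1 c) = recip-inverseʳ d-1
        eq : fromℤ (sgn (↥ x)) * ι ℤ.∣ ↥ x ∣ * recip (↧ₙ x) ≡ x
        eq = begin
          fromℤ (sgn (↥ x)) * ι ℤ.∣ ↥ x ∣ * recip (↧ₙ x) ≡⟨ cong (_* recip (↧ₙ x)) (sym (sgn-abs (↥ x))) ⟩
          fromℤ (↥ x) * recip (↧ₙ x)                     ≡⟨ cong (_* recip (↧ₙ x)) (x*↧x≡↥x x) ⟨
          x * ι (↧ₙ x) * recip (↧ₙ x)                    ≡⟨ ℚ.*-assoc x _ _ ⟩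
          x * (ι (↧ₙ x) * recip (↧ₙ x))                  ≡⟨ cong (x *_) (den-inverse x) ⟩
          x * 1ℚ                                         ≡⟨ ℚ.*-identityʳ x ⟩
          x                                              ∎

  infix 4 _≈_[_]

  record _≈_[_] (x y : ℚ) (m : ℕ) : Set where
    constructor mk≈
    field
      difference : V m (x - y)

  open _≈_[_] public

  ≈-reflexive : ∀ {m x y} → x ≡ y → x ≈ y [ m ]
  ≈-reflexive {m} {x} refl = mk≈ (subst (V m) (sym (ℚ.+-inverseʳ x)) (V-0 m))

  ≈-refl : ∀ {m x} → x ≈ x [ m ]
  ≈-refl = ≈-reflexive refl

  ≈-sym : ∀ {m x y} → x ≈ y [ m ] → y ≈ x [ m ]
  ≈-sym {m} {x} {y} (mk≈ d) = mk≈ (subst (V m) (rearrange x y) (V-neg d))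
    where
    rearrange : ∀ x y → - (x - y) ≡ y - x
    rearrange = solve-∀ ringℚ

  ≈-trans : ∀ {m x y z} → x ≈ y [ m ] → y ≈ z [ m ] → x ≈ z [ m ]
  ≈-trans {m} {x} {y} {z} (mk≈ d) (mk≈ e) = mk≈ (subst (V m) (rearrange x y z) (V-+ d e))
    where
    rearrange : ∀ x y z → (x - y) + (y - z) ≡ x - z
    rearrange = solve-∀ ringℚ

  ≈-setoid : ℕ → Setoid 0ℓ 0ℓ
  ≈-setoid m = record
    { Carrier       = ℚ
    ; _≈_           = λ x y → x ≈ y [ m ]
    ; isEquivalence = record { refl = ≈-refl ; sym = ≈-sym ; trans = ≈-trans }
    }

  ≈-+ : ∀ {m x y u v} → x ≈ y [ m ] → u ≈ v [ m ] → x + u ≈ y + v [ m ]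
  ≈-+ {m} {x} {y} {u} {v} (mk≈ d) (mk≈ e) = mk≈ (subst (V m) (rearrange x y u v) (V-+ d e))
    where
    rearrange : ∀ x y u v → (x - y) + (u - v) ≡ (x + u) - (y + v)
    rearrange = solve-∀ ringℚ

  -- This is how congruences modulo p yield congruences modulo p²: a factor π or x supplies the
  -- missing power.
  ≈-scale : ∀ {m n c x y} → V n c → x ≈ y [ m ] → c * x ≈ c * y [ n ℕ.+ m ]
  ≈-scale {m} {n} {c} {x} {y} Vc (mk≈ d) = mk≈ (subst (V (n ℕ.+ m)) (rearrange c x y) (V-*-V Vc d))
    where
    rearrange : ∀ c x y → c * (x - y) ≡ c * x - c * y
    rearrange = solve-∀ ringℚ

  ≈-*ˡ : ∀ {m c x y} → Int c → x ≈ y [ m ] → c * x ≈ c * y [ m ]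
  ≈-*ˡ Ic = ≈-scale (Int⇒V0 Ic)

  ≈-*ʳ : ∀ {m c x y} → Int c → x ≈ y [ m ] → x * c ≈ y * c [ m ]
  ≈-*ʳ {m} {c} {x} {y} Ic d = subst₂ (_≈_[ m ]) (ℚ.*-comm c x) (ℚ.*-comm c y) (≈-*ˡ Ic d)

  ≈-neg : ∀ {m x y} → x ≈ y [ m ] → - x ≈ - y [ m ]
  ≈-neg {m} {x} {y} (mk≈ d) = mk≈ (subst (V m) (rearrange x y) (V-neg d))
    where
    rearrange : ∀ x y → - (x - y) ≡ - x - - y
    rearrange = solve-∀ ringℚ

  ≈-- : ∀ {m x y u v} → x ≈ y [ m ] → u ≈ v [ m ] → x - u ≈ y - v [ m ]
  ≈-- d e = ≈-+ d (≈-neg e)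

  V⇒≈0 : ∀ {m x} → V m x → x ≈ 0ℚ [ m ]
  V⇒≈0 {m} {x} Vx = mk≈ (subst (V m) (sym (ℚ.+-identityʳ x)) Vx)

  ≈0⇒V : ∀ {m x} → x ≈ 0ℚ [ m ] → V m x
  ≈0⇒V {m} {x} (mk≈ d) = subst (V m) (ℚ.+-identityʳ x) d

  sum1-≈ : ∀ {m} n {f g : ℕ → ℚ} → (∀ k → suc k ≤ n → f (suc k) ≈ g (suc k) [ m ]) →
           sum1 n f ≈ sum1 n g [ m ]
  sum1-≈ zero    eq = ≈-refl
  sum1-≈ (suc n) eq = ≈-+ (sum1-≈ n (λ k k<n → eq k (ℕ.m≤n⇒m≤1+n k<n))) (eq n ℕ.≤-refl)

  sum0-V : ∀ {m} n {f : ℕ → ℚ} → (∀ k → k ≤ n → V m (f k)) → V m (sum0 n f)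
  sum0-V zero    h = h 0 z≤n
  sum0-V (suc n) h = V-+ (sum0-V n (λ k k≤n → h k (ℕ.m≤n⇒m≤1+n k≤n))) (h (suc n) ℕ.≤-refl)

  Int-sum0 : ∀ n {f : ℕ → ℚ} → (∀ k → k ≤ n → Int (f k)) → Int (sum0 n f)
  Int-sum0 n h = V⇒Int (sum0-V n (λ k k≤n → Int⇒V0 (h k k≤n)))

-- Generalised binomial coefficients

sign : ℕ → ℚ
sign k = (- 1ℚ) ^ k

sign-even : ∀ k → sign (k ℕ.+ k) ≡ 1ℚ
sign-even k = trans (neg-^-even 1ℚ k) (1^n≡1 (k ℕ.+ k))

sign*sign : ∀ k → sign k * sign k ≡ 1ℚ
sign*sign k = trans (sym (^-+ (- 1ℚ) k k)) (sign-even k)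

falling-suc : ∀ y k → falling (y + 1ℚ) (suc k) ≡ (y + 1ℚ) * falling y k
falling-suc y zero    = base y
  where
  base : ∀ y → 1ℚ * (y + 1ℚ - 0ℚ) ≡ (y + 1ℚ) * 1ℚ
  base = solve-∀ ringℚ
falling-suc y (suc k) = begin
  falling (y + 1ℚ) (suc k) * (y + 1ℚ - ι (suc k))    ≡⟨ cong₂ (λ u v → u * (y + 1ℚ - v)) (falling-suc y k) (ι-suc k) ⟩
  (y + 1ℚ) * falling y k * (y + 1ℚ - (ι k + 1ℚ))     ≡⟨ rearrange y (falling y k) (ι k) ⟩
  (y + 1ℚ) * (falling y k * (y - ι k))               ∎
  where
  open ≡-Reasoning
  rearrange : ∀ y f k → (y + 1ℚ) * f * (y + 1ℚ - (k + 1ℚ)) ≡ (y + 1ℚ) * (f * (y - k))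
  rearrange = solve-∀ ringℚ

1/! : ℕ → ℚ
1/! k = (+ 1) / (k !)
  where instance _ = k ℕ.!≢0

!-inverse : ∀ k → ι (k !) * 1/! k ≡ 1ℚ
!-inverse k = inverse (k !) {{k ℕ.!≢0}}
  where
  inverse : ∀ n .{{_ : ℕ.NonZero n}} → ι n * ((+ 1) / n) ≡ 1ℚ
  inverse (suc n) = recip-inverseʳ n

!-cancelˡ : ∀ k {x y} → ι (k !) * x ≡ ι (k !) * y → x ≡ y
!-cancelˡ k = *-cancelˡ-inverse (ι (k !)) (!-inverse k)

!*binom : ∀ x k → ι (k !) * binom x k ≡ falling x k
!*binom x k = begin
  ι (k !) * (falling x k * 1/! k)   ≡⟨ rearrange (ι (k !)) (falling x k) (1/! k) ⟩
  falling x k * (ι (k !) * 1/! k)   ≡⟨ cong (falling x k *_) (!-inverse k) ⟩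
  falling x k * 1ℚ                  ≡⟨ ℚ.*-identityʳ (falling x k) ⟩
  falling x k                       ∎
  where
  open ≡-Reasoning
  rearrange : ∀ a b c → a * (b * c) ≡ b * (a * c)
  rearrange = solve-∀ ringℚ

!*suc*binom : ∀ x k → ι (k !) * (ι (suc k) * binom x (suc k)) ≡ falling x (suc k)
!*suc*binom x k = begin
  ι (k !) * (ι (suc k) * binom x (suc k))  ≡⟨ rearrange (ι (k !)) (ι (suc k)) (binom x (suc k)) ⟩
  ι (suc k) * ι (k !) * binom x (suc k)    ≡⟨ cong (_* binom x (suc k)) (ι-* (suc k) (k !)) ⟨
  ι (suc k !) * binom x (suc k)            ≡⟨ !*binom x (suc k) ⟩
  falling x (suc k)                        ∎
  where
  open ≡-Reasoning
  rearrange : ∀ a b c → a * (b * c) ≡ b * a * c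
  rearrange = solve-∀ ringℚ

binom-sucʳ : ∀ x k → ι (suc k) * binom x (suc k) ≡ binom x k * (x - ι k)
binom-sucʳ x k = !-cancelˡ k (begin
  ι (k !) * (ι (suc k) * binom x (suc k))  ≡⟨ !*suc*binom x k ⟩
  falling x k * (x - ι k)                  ≡⟨ cong (_* (x - ι k)) (!*binom x k) ⟨
  ι (k !) * binom x k * (x - ι k)          ≡⟨ ℚ.*-assoc (ι (k !)) (binom x k) (x - ι k) ⟩
  ι (k !) * (binom x k * (x - ι k))        ∎)
  where open ≡-Reasoning

binom-sucˡ : ∀ y k → ι (suc k) * binom (y + 1ℚ) (suc k) ≡ (y + 1ℚ) * binom y k
binom-sucˡ y k = !-cancelˡ k (begin
  ι (k !) * (ι (suc k) * binom (y + 1ℚ) (suc k))  ≡⟨ !*suc*binom (y + 1ℚ) k ⟩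
  falling (y + 1ℚ) (suc k)                        ≡⟨ falling-suc y k ⟩
  (y + 1ℚ) * falling y k                          ≡⟨ cong ((y + 1ℚ) *_) (!*binom y k) ⟨
  (y + 1ℚ) * (ι (k !) * binom y k)                ≡⟨ rearrange (y + 1ℚ) (ι (k !)) (binom y k) ⟩
  ι (k !) * ((y + 1ℚ) * binom y k)                ∎)
  where
  open ≡-Reasoning
  rearrange : ∀ a b c → a * (b * c) ≡ b * (a * c)
  rearrange = solve-∀ ringℚ

recip-solve : ∀ k {x y} → ι (suc k) * x ≡ y → x ≡ recip (suc k) * y
recip-solve k {x} {y} eq = begin
  x                               ≡⟨ ℚ.*-identityˡ x ⟨
  1ℚ * x                          ≡⟨ cong (_* x) (recip-inverseʳ k) ⟨
  ι (suc k) * recip (suc k) * x   ≡⟨ rearrange (ι (suc k)) (recip (suc k)) x ⟩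
  recip (suc k) * (ι (suc k) * x) ≡⟨ cong (recip (suc k) *_) eq ⟩
  recip (suc k) * y               ∎
  where
  open ≡-Reasoning
  rearrange : ∀ a b c → a * b * c ≡ b * (a * c)
  rearrange = solve-∀ ringℚ

binom-pascal : ∀ y k → binom (y + 1ℚ) (suc k) ≡ binom y (suc k) + binom y k
binom-pascal y k = ι-cancelˡ k (begin
  ι (suc k) * binom (y + 1ℚ) (suc k)                ≡⟨ binom-sucˡ y k ⟩
  (y + 1ℚ) * binom y k                              ≡⟨ rearrange y (binom y k) (ι k) ⟩
  binom y k * (y - ι k) + (ι k + 1ℚ) * binom y k    ≡⟨ cong₂ (λ u v → u + v * binom y k) (binom-sucʳ y k) (ι-suc k) ⟨
  ι (suc k) * binom y (suc k) + ι (suc k) * binom y k ≡⟨ ℚ.*-distribˡ-+ (ι (suc k)) (binom y (suc k)) (binom y k) ⟨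
  ι (suc k) * (binom y (suc k) + binom y k)         ∎)
  where
  open ≡-Reasoning
  rearrange : ∀ y c k → (y + 1ℚ) * c ≡ c * (y - k) + (k + 1ℚ) * c
  rearrange = solve-∀ ringℚ

-- The two sums of the theorem and their differences

alternatingSum : ℕ → ℚ → ℚ
alternatingSum n x = sum1 n (λ k → sign (k ∸ 1) * recip k * binom x k)

productSum : ℕ → ℚ → ℚ
productSum n x = sum1 n (λ k → binom x k * binom (- 1ℚ - x) k * recip k)

-- By Pascal the k-th terms differ by (-1)^(k-1)/k C(y, k-1), and (y + 1)/k C(y, k-1) = C(y+1, k) =
-- C(y, k) + C(y, k-1), so the alternating sum telescopes.
alternatingSum-difference : ∀ n y →
  (y + 1ℚ) * (alternatingSum n (y + 1ℚ) - alternatingSum n y) ≡ 1ℚ - sign n * binom y n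
alternatingSum-difference zero    y = base y
  where
  base : ∀ y → (y + 1ℚ) * (0ℚ - 0ℚ) ≡ 1ℚ - 1ℚ * 1ℚ
  base = solve-∀ ringℚ
alternatingSum-difference (suc n) y = begin
  b * (A + e * r * C₁ - (A′ + e * r * C₂))        ≡⟨ cong (λ c → b * (A + e * r * c - (A′ + e * r * C₂))) (binom-pascal y n) ⟩
  b * (A + e * r * (C₂ + C₀) - (A′ + e * r * C₂))  ≡⟨ split b A A′ e r C₂ C₀ ⟩
  b * (A - A′) + e * (r * (b * C₀))              ≡⟨ cong₂ (λ u v → u + e * v) (alternatingSum-difference n y) (sym (recip-solve n (binom-sucˡ y n))) ⟩
  1ℚ - e * C₀ + e * C₁                           ≡⟨ cong (λ c → 1ℚ - e * C₀ + e * c) (binom-pascal y n) ⟩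
  1ℚ - e * C₀ + e * (C₂ + C₀)                     ≡⟨ merge e C₂ C₀ ⟩
  1ℚ - - 1ℚ * e * C₂                              ∎
  where
  open ≡-Reasoning
  b A A′ e r C₂ C₀ C₁ : ℚ
  b  = y + 1ℚ
  A  = alternatingSum n (y + 1ℚ)
  A′ = alternatingSum n y
  e  = sign n
  r  = recip (suc n)
  C₂  = binom y (suc n)
  C₀ = binom y n
  C₁ = binom (y + 1ℚ) (suc n)
  split : ∀ b A A′ e r C₂ C₀ → b * (A + e * r * (C₂ + C₀) - (A′ + e * r * C₂)) ≡ b * (A - A′) + e * (r * (b * C₀))
  split = solve-∀ ringℚ
  merge : ∀ e C₂ C₀ → 1ℚ - e * C₀ + e * (C₂ + C₀) ≡ 1ℚ - - 1ℚ * e * C₂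
  merge = solve-∀ ringℚ

-- Put b = y + 1, N = n + 1 and P = C(b-1, n) C(-1-b, n). The N-th term changes by an amount which,
-- times b, is - 2 (b²/N²) P, while C(b-1, N) C(-1-b, N) = (1 - b²/N²) P; so the sum telescopes.
productSum-difference : ∀ n y →
  (y + 1ℚ) * (productSum n (y + 1ℚ) - productSum n y)
    ≡ (1ℚ + 1ℚ) * (binom y n * binom (- 1ℚ - (y + 1ℚ)) n - 1ℚ)
productSum-difference zero    y = base y
  where
  base : ∀ y → (y + 1ℚ) * (0ℚ - 0ℚ) ≡ (1ℚ + 1ℚ) * (1ℚ * 1ℚ * (1ℚ * 1ℚ) - 1ℚ)
  base = solve-∀ ringℚ
productSum-difference (suc n) y = begin
  b * (F + binom b (suc n) * binom z (suc n) * r - (F′ + binom y (suc n) * binom (- 1ℚ - y) (suc n) * r))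
    ≡⟨ split b F F′ (binom b (suc n)) (binom z (suc n)) (binom y (suc n)) (binom (- 1ℚ - y) (suc n)) r ⟩
  b * (F - F′) + b * r * (binom b (suc n) * binom z (suc n) - binom y (suc n) * binom (- 1ℚ - y) (suc n))
    ≡⟨ cong₂ (λ s t → s + b * r * t) (productSum-difference n y)
         (cong₂ _-_ (cong₂ _*_ (recip-solve n (binom-sucˡ y n)) (recip-solve n (binom-sucʳ z n)))
                    (cong₂ _*_ (recip-solve n (binom-sucʳ y n)) (trans (cong (λ w → binom w (suc n)) (shift y)) (recip-solve n (binom-sucˡ z n))))) ⟩
  (1ℚ + 1ℚ) * (u * v - 1ℚ)
    + b * r * (r * (b * u) * (r * (v * (z - ι n))) - r * (u * (y - ι n)) * (r * ((z + 1ℚ) * v)))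
    -- The ring solver does not know r = 1/(n + 1), so the product (n + 1) r is isolated, replaced
    -- by 1, and put back squared where the target needs it.
    ≡⟨ collect y r (ι n) u v ⟩
  (1ℚ + 1ℚ) * (u * v - 1ℚ + ((ι n + 1ℚ) * r) * (- (r * r * (b * b) * (u * v))))
    ≡⟨ cong (λ s → (1ℚ + 1ℚ) * (u * v - 1ℚ + s * (- (r * r * (b * b) * (u * v))))) N*r≡1 ⟩
  (1ℚ + 1ℚ) * (u * v - 1ℚ + 1ℚ * (- (r * r * (b * b) * (u * v))))
    ≡⟨ drop1 u v r b ⟩
  (1ℚ + 1ℚ) * (1ℚ * 1ℚ * (u * v) - r * r * (b * b) * (u * v) - 1ℚ)
    ≡⟨ cong (λ s → (1ℚ + 1ℚ) * (s * s * (u * v) - r * r * (b * b) * (u * v) - 1ℚ)) N*r≡1 ⟨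
  (1ℚ + 1ℚ) * (((ι n + 1ℚ) * r) * ((ι n + 1ℚ) * r) * (u * v) - r * r * (b * b) * (u * v) - 1ℚ)
    ≡⟨ expand y r (ι n) u v ⟩
  (1ℚ + 1ℚ) * (r * (u * (y - ι n)) * (r * (v * (z - ι n))) - 1ℚ)
    ≡⟨ cong₂ (λ s t → (1ℚ + 1ℚ) * (s * t - 1ℚ)) (recip-solve n (binom-sucʳ y n)) (recip-solve n (binom-sucʳ z n)) ⟨
  (1ℚ + 1ℚ) * (binom y (suc n) * binom z (suc n) - 1ℚ) ∎
  where
  open ≡-Reasoning
  b z F F′ r u v : ℚ
  b  = y + 1ℚ
  z  = - 1ℚ - (y + 1ℚ)
  F  = productSum n (y + 1ℚ)
  F′ = productSum n y
  r  = recip (suc n)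
  u  = binom y n
  v  = binom z n
  shift : ∀ y → - 1ℚ - y ≡ - 1ℚ - (y + 1ℚ) + 1ℚ
  shift = solve-∀ ringℚ
  N*r≡1 : (ι n + 1ℚ) * r ≡ 1ℚ
  N*r≡1 = trans (cong (_* r) (sym (ι-suc n))) (recip-inverseʳ n)
  split : ∀ b F F′ p q s t r → b * (F + p * q * r - (F′ + s * t * r)) ≡ b * (F - F′) + b * r * (p * q - s * t)
  split = solve-∀ ringℚ
  collect : ∀ y r n u v →
    (1ℚ + 1ℚ) * (u * v - 1ℚ)
      + (y + 1ℚ) * r * (r * ((y + 1ℚ) * u) * (r * (v * (- 1ℚ - (y + 1ℚ) - n)))
                     - r * (u * (y - n)) * (r * ((- 1ℚ - (y + 1ℚ) + 1ℚ) * v)))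
    ≡ (1ℚ + 1ℚ) * (u * v - 1ℚ + ((n + 1ℚ) * r) * (- (r * r * ((y + 1ℚ) * (y + 1ℚ)) * (u * v))))
  collect = solve-∀ ringℚ
  drop1 : ∀ u v r b → (1ℚ + 1ℚ) * (u * v - 1ℚ + 1ℚ * (- (r * r * (b * b) * (u * v))))
    ≡ (1ℚ + 1ℚ) * (1ℚ * 1ℚ * (u * v) - r * r * (b * b) * (u * v) - 1ℚ)
  drop1 = solve-∀ ringℚ
  expand : ∀ y r n u v →
    (1ℚ + 1ℚ) * (((n + 1ℚ) * r) * ((n + 1ℚ) * r) * (u * v) - r * r * ((y + 1ℚ) * (y + 1ℚ)) * (u * v) - 1ℚ)
    ≡ (1ℚ + 1ℚ) * (r * (u * (y - n)) * (r * (v * (- 1ℚ - (y + 1ℚ) - n))) - 1ℚ)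
  expand = solve-∀ ringℚ

-- With b = y + 1 the left side is b (b - 1) ... (b - h) times (-1)^h (b + 1) ... (b + h): up to
-- sign, the 2h + 1 consecutive factors from b + h down to b - h.
falling-central : ∀ h y →
  (y + 1ℚ) * falling y h * falling (- 1ℚ - (y + 1ℚ)) h
    ≡ sign h * falling (y + 1ℚ + ι h) (suc (h ℕ.+ h))
falling-central zero    y = base y
  where
  base : ∀ y → (y + 1ℚ) * 1ℚ * 1ℚ ≡ 1ℚ * (1ℚ * (y + 1ℚ + 0ℚ - 0ℚ))
  base = solve-∀ ringℚ
falling-central (suc h) y = begin
  b * (falling y h * (y - ι h)) * (falling z h * (z - ι h))      ≡⟨ split y (falling y h) (falling z h) (ι h) ⟩
  b * falling y h * falling z h * ((y - ι h) * (z - ι h))        ≡⟨ cong (_* ((y - ι h) * (z - ι h))) (falling-central h y) ⟩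
  sign h * Φ * ((y - ι h) * (z - ι h))                           ≡⟨ merge y (sign h) Φ (ι h) ⟩
  - 1ℚ * sign h * ((w + 1ℚ) * (Φ * (w - (ι h + ι h + 1ℚ))))      ≡⟨ cong (λ k → - 1ℚ * sign h * ((w + 1ℚ) * (Φ * (w - k)))) (trans (ι-suc (h ℕ.+ h)) (cong (_+ 1ℚ) (ι-+ h h))) ⟨
  - 1ℚ * sign h * ((w + 1ℚ) * falling w (suc (suc (h ℕ.+ h))))   ≡⟨ cong (- 1ℚ * sign h *_) (falling-suc w (suc (suc (h ℕ.+ h)))) ⟨
  - 1ℚ * sign h * falling (w + 1ℚ) (suc (suc (suc (h ℕ.+ h))))   ≡⟨ cong₂ (λ s k → - 1ℚ * sign h * falling s (suc (suc k))) shift (sym (ℕ.+-suc h h)) ⟩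
  - 1ℚ * sign h * falling (b + ι (suc h)) (suc (suc h ℕ.+ suc h)) ∎
  where
  open ≡-Reasoning
  b z w Φ : ℚ
  b = y + 1ℚ
  z = - 1ℚ - (y + 1ℚ)
  w = y + 1ℚ + ι h
  Φ = falling w (suc (h ℕ.+ h))
  shift : w + 1ℚ ≡ b + ι (suc h)
  shift = trans (ℚ.+-assoc b (ι h) 1ℚ) (cong (λ s → b + s) (sym (ι-suc h)))
  split : ∀ y f g k → (y + 1ℚ) * (f * (y - k)) * (g * (- 1ℚ - (y + 1ℚ) - k))
    ≡ (y + 1ℚ) * f * g * ((y - k) * (- 1ℚ - (y + 1ℚ) - k))
  split = solve-∀ ringℚ
  merge : ∀ y e Φ k → e * Φ * ((y - k) * (- 1ℚ - (y + 1ℚ) - k))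
    ≡ - 1ℚ * e * ((y + 1ℚ + k + 1ℚ) * (Φ * (y + 1ℚ + k - (k + k + 1ℚ))))
  merge = solve-∀ ringℚ

falling-ι : ∀ n k → falling (ι (n ℕ.+ k)) k * ι (n !) ≡ ι ((n ℕ.+ k) !)
falling-ι n zero    = trans (ℚ.*-identityˡ (ι (n !))) (cong (λ m → ι (m !)) (sym (ℕ.+-identityʳ n)))
falling-ι n (suc k) rewrite ℕ.+-suc n k = begin
  falling (ι (suc (n ℕ.+ k))) (suc k) * ι (n !)       ≡⟨ cong (λ s → falling s (suc k) * ι (n !)) (ι-suc (n ℕ.+ k)) ⟩
  falling (ι (n ℕ.+ k) + 1ℚ) (suc k) * ι (n !)        ≡⟨ cong (_* ι (n !)) (falling-suc (ι (n ℕ.+ k)) k) ⟩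
  (ι (n ℕ.+ k) + 1ℚ) * falling (ι (n ℕ.+ k)) k * ι (n !)  ≡⟨ ℚ.*-assoc (ι (n ℕ.+ k) + 1ℚ) (falling (ι (n ℕ.+ k)) k) (ι (n !)) ⟩
  (ι (n ℕ.+ k) + 1ℚ) * (falling (ι (n ℕ.+ k)) k * ι (n !)) ≡⟨ cong₂ _*_ (sym (ι-suc (n ℕ.+ k))) (falling-ι n k) ⟩
  ι (suc (n ℕ.+ k)) * ι ((n ℕ.+ k) !)                 ≡⟨ ι-* (suc (n ℕ.+ k)) ((n ℕ.+ k) !) ⟨
  ι (suc (n ℕ.+ k) !)                                 ∎
  where open ≡-Reasoning

-- Dividing `falling-central` by h!² leaves (2h+1)!/h!² = (2h + 1) C(2h, h); for p = 2h + 1 this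
-- puts a factor p in front.
binom-central : ∀ h y →
  (y + 1ℚ) * (binom y h * binom (- 1ℚ - (y + 1ℚ)) h)
    ≡ ι (suc (h ℕ.+ h)) * (sign h * binom (ι (h ℕ.+ h)) h * binom (y + 1ℚ + ι h) (suc (h ℕ.+ h)))
binom-central h y = !-cancelˡ h (!-cancelˡ h (begin
  f * (f * (b * (binom y h * binom z h)))             ≡⟨ split f b (binom y h) (binom z h) ⟩
  b * (f * binom y h) * (f * binom z h)               ≡⟨ cong₂ (λ s t → b * s * t) (!*binom y h) (!*binom z h) ⟩
  b * falling y h * falling z h                       ≡⟨ falling-central h y ⟩
  sign h * falling (b + ι h) (suc n)                  ≡⟨ cong (sign h *_) (!*binom (b + ι h) (suc n)) ⟨
  sign h * (ι (suc n !) * D)                          ≡⟨ cong (λ s → sign h * (s * D)) (ι-* (suc n) (n !)) ⟩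
  sign h * (ι (suc n) * ι (n !) * D)                  ≡⟨ cong (λ s → sign h * (ι (suc n) * s * D)) (falling-ι h h) ⟨
  sign h * (ι (suc n) * (falling (ι n) h * f) * D)    ≡⟨ cong (λ s → sign h * (ι (suc n) * (s * f) * D)) (!*binom (ι n) h) ⟨
  sign h * (ι (suc n) * (f * binom (ι n) h * f) * D)  ≡⟨ merge f (sign h) (ι (suc n)) (binom (ι n) h) D ⟩
  f * (f * (ι (suc n) * (sign h * binom (ι n) h * D))) ∎))
  where
  open ≡-Reasoning
  n : ℕ
  n = h ℕ.+ h
  b z f D : ℚ
  b = y + 1ℚ
  z = - 1ℚ - (y + 1ℚ)
  f = ι (h !)
  D = binom (y + 1ℚ + ι h) (suc n)
  split : ∀ f b s t → f * (f * (b * (s * t))) ≡ b * (f * s) * (f * t)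
  split = solve-∀ ringℚ
  merge : ∀ f e N s D → e * (N * (f * s * f) * D) ≡ f * (f * (N * (e * s * D)))
  merge = solve-∀ ringℚ

-- Only meaningful for x ≢ 0ℚ, where it is 1/ x; total so that it can be summed.
inv : ℚ → ℚ
inv x with x ℚ.≟ 0ℚ
... | yes _  = 0ℚ
... | no x≢0 = 1/_ x {{ℚ.≢-nonZero x≢0}}

inv-unique : ∀ x c → x * c ≡ 1ℚ → inv x ≡ c
inv-unique x c xc≡1 with x ℚ.≟ 0ℚ
... | yes refl = contradiction (trans (sym (ℚ.*-zeroˡ c)) xc≡1) λ ()
... | no x≢0   = *-cancelˡ-inverse x xc≡1 (trans (ℚ.*-inverseʳ x {{ℚ.≢-nonZero x≢0}}) (sym xc≡1))

-- Binomial coefficients modulo p and the steps of the descent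

module Binomials (q : ℕ) (p-prime : Prime (suc q)) where

  open Local (suc q) p-prime public

  private
    p : ℕ
    p = suc q

  inv-unit : ∀ x → (∃ λ c → Int c × x * c ≡ 1ℚ) → Int (inv x) × x * inv x ≡ 1ℚ
  inv-unit x (c , Ic , xc≡1) =
    subst (λ d → Int d × x * d ≡ 1ℚ) (sym (inv-unique x c xc≡1)) (Ic , xc≡1)

  Int-recip-≤ : ∀ {k} → suc k ≤ q → Int (recip (suc k))
  Int-recip-≤ k<q = Int-recip (p∤suc (s≤s k<q))

  Int-binom : ∀ {x} k → k ≤ q → Int x → Int (binom x k)
  Int-binom         zero    k≤q Ix = Int-ι 1
  Int-binom {x = x} (suc k) k<q Ix = subst Int (sym (recip-solve k (binom-sucʳ x k)))
    (Int-* (Int-recip-≤ k<q) (Int-* (Int-binom k (ℕ.<⇒≤ k<q) Ix) (Int-- Ix (Int-ι k))))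

  -- Because j < k, the numerator contains the factor x + j - j = x, while k! is prime to p.
  V-binom : ∀ {x} j k → j < k → k ≤ q → V 1 x → V 1 (binom (x + ι j) k)
  V-binom {x} j (suc k) (s≤s j≤k) k<q Vx = subst (V 1) (sym (recip-solve k (binom-sucʳ (x + ι j) k)))
    (V-*ˡ (Int-recip-≤ k<q) (factor (ℕ.m≤n⇒m<n∨m≡n j≤k)))
    where
    cancel : ∀ x j → x ≡ x + j - j
    cancel = solve-∀ ringℚ
    I : ∀ i → Int (x + ι i)
    I i = Int-+ (V⇒Int Vx) (Int-ι i)
    factor : j < k ⊎ j ≡ k → V 1 (binom (x + ι j) k * (x + ι j - ι k))
    factor (inj₁ j<k)  = V-*ʳ (V-binom j k j<k (ℕ.<⇒≤ k<q) Vx) (Int-- (I j) (Int-ι k))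
    factor (inj₂ refl) = V-*ˡ (Int-binom k (ℕ.<⇒≤ k<q) (I k)) (subst (V 1) (cancel x (ι k)) Vx)

  -- Here y ≡ -1 and C(-1, k) = (-1)^k. In Pascal's rule C(y+1, k+1) drops out, as it has the factor
  -- y + 1.
  binom≈sign : ∀ {y} k → k ≤ q → V 1 (y + 1ℚ) → binom y k ≈ sign k [ 1 ]
  binom≈sign     zero    k≤q Vy+1 = ≈-refl
  binom≈sign {y} (suc k) k<q Vy+1 = begin
    binom y (suc k)                      ≡⟨ isolate (binom y (suc k)) (binom y k) ⟩
    binom y (suc k) + binom y k - binom y k ≡⟨ cong (_- binom y k) (binom-pascal y k) ⟨
    binom (y + 1ℚ) (suc k) - binom y k   ≈⟨ ≈-- (V⇒≈0 V-left) (binom≈sign k (ℕ.<⇒≤ k<q) Vy+1) ⟩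
    0ℚ - sign k                          ≡⟨ neg (sign k) ⟩
    - 1ℚ * sign k                        ∎
    where
    open SetoidReasoning (≈-setoid 1)
    isolate : ∀ a b → a ≡ a + b - b
    isolate = solve-∀ ringℚ
    neg : ∀ e → 0ℚ - e ≡ - 1ℚ * e
    neg = solve-∀ ringℚ
    restore : ∀ y → y + 1ℚ - 1ℚ ≡ y
    restore = solve-∀ ringℚ
    Iy : Int y
    Iy = subst Int (restore y) (Int-- (V⇒Int Vy+1) (Int-ι 1))
    V-left : V 1 (binom (y + 1ℚ) (suc k))
    V-left = subst (V 1) (sym (recip-solve k (binom-sucˡ y k)))
      (V-*ˡ (Int-recip-≤ k<q) (V-*ʳ Vy+1 (Int-binom k (ℕ.<⇒≤ k<q) Iy)))

  module Shifted (h : ℕ) (q≡h+h : q ≡ h ℕ.+ h) where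

    h≤q : h ≤ q
    h≤q = subst (h ≤_) (sym q≡h+h) (ℕ.m≤m+n h h)

    sign-q : sign q ≡ 1ℚ
    sign-q = trans (cong sign q≡h+h) (sign-even h)

    x+ι[suc] : ∀ x j → x + ι (suc j) ≡ x + ι j + 1ℚ
    x+ι[suc] x j = trans (cong (λ s → x + s) (ι-suc j)) (sym (ℚ.+-assoc x (ι j) 1ℚ))

    -- A case of Lucas' theorem: the residue of binom (p t + j) p is t.
    binom-p : ∀ {t} j → j ≤ q → Int t → binom (π * t + ι j) p ≈ t [ 1 ]
    binom-p {t} zero    j≤q It = begin
      binom (π * t + 0ℚ) p   ≡⟨ cong (λ s → binom s p) (decompose (π * t)) ⟩
      binom (y + 1ℚ) p       ≡⟨ ι-cancelˡ q (trans (binom-sucˡ y q) (trans (cong (_* binom y q) (restore (π * t))) (ℚ.*-assoc π t (binom y q)))) ⟩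
      t * binom y q          ≈⟨ ≈-*ˡ It (binom≈sign q ℕ.≤-refl (subst (V 1) (sym (restore (π * t))) (V-*ʳ V-π It))) ⟩
      t * sign q             ≡⟨ trans (cong (t *_) sign-q) (ℚ.*-identityʳ t) ⟩
      t                      ∎
      where
      open SetoidReasoning (≈-setoid 1)
      y : ℚ
      y = π * t - 1ℚ
      decompose : ∀ x → x + 0ℚ ≡ x - 1ℚ + 1ℚ
      decompose = solve-∀ ringℚ
      restore : ∀ x → x - 1ℚ + 1ℚ ≡ x
      restore = solve-∀ ringℚ
    binom-p {t} (suc j) j<q It = begin
      binom (x + ι (suc j)) p                ≡⟨ cong (λ s → binom s p) (x+ι[suc] x j) ⟩
      binom (x + ι j + 1ℚ) p                 ≡⟨ binom-pascal (x + ι j) q ⟩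
      binom (x + ι j) p + binom (x + ι j) q  ≈⟨ ≈-+ (binom-p j (ℕ.<⇒≤ j<q) It) (V⇒≈0 (V-binom j q j<q ℕ.≤-refl (V-*ʳ V-π It))) ⟩
      t + 0ℚ                                 ≡⟨ ℚ.+-identityʳ t ⟩
      t                                      ∎
      where
      open SetoidReasoning (≈-setoid 1)
      x : ℚ
      x = π * t

    -- p t + p + j = p (t + 1) + j, so `binom-p` applies with t + 1.
    binom-p-carry : ∀ {t} j → j ≤ q → Int t → binom (π * t + ι (p ℕ.+ j)) p ≈ t + 1ℚ [ 1 ]
    binom-p-carry {t} j j≤q It = subst (λ s → binom s p ≈ t + 1ℚ [ 1 ])
      (trans (rearrange π t (ι j)) (cong (λ s → π * t + s) (sym (ι-+ p j))))
      (binom-p j j≤q (Int-+ It (Int-ι 1)))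
      where
      rearrange : ∀ π t j → π * (t + 1ℚ) + j ≡ π * t + (π + j)
      rearrange = solve-∀ ringℚ

    combinedSum : ℚ → ℚ
    combinedSum x = productSum h x + (1ℚ + 1ℚ) * alternatingSum q x

    module Residue (t : ℚ) (It : Int t) where

      x : ℚ
      x = π * t

      b c : ℕ → ℚ
      b j = x + ι j
      c j = inv (b j)

      Vx : V 1 x
      Vx = V-*ʳ V-π It

      Ib : ∀ j → Int (b j)
      Ib j = Int-+ (V⇒Int Vx) (Int-ι j)

      b-suc : ∀ j → b (suc j) ≡ b j + 1ℚ
      b-suc = x+ι[suc] x

      -- Since p divides x, a non-unit b (suc j) would force p to divide suc j, which lies strictly
      -- between 0 and p.
      b-unit : ∀ j → suc j ≤ q → Int (c (suc j)) × b (suc j) * c (suc j) ≡ 1ℚ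
      b-unit j j<q = inv-unit (b (suc j)) (invertible (b (suc j)) (Ib (suc j)) ¬Vb)
        where
        cancel : ∀ x i → x + i + - x ≡ i
        cancel = solve-∀ ringℚ
        ¬Vb : ¬ V 1 (b (suc j))
        ¬Vb Vb = p∤suc (s≤s j<q) (V1-ι⇒∣ (subst (V 1) (cancel x (ι (suc j))) (V-+ Vb (V-neg Vx))))

      Ic : ∀ j → suc j ≤ q → Int (c (suc j))
      Ic j j<q = proj₁ (b-unit j j<q)

      b*c : ∀ j → suc j ≤ q → b (suc j) * c (suc j) ≡ 1ℚ
      b*c j j<q = proj₂ (b-unit j j<q)

      solve-b : ∀ j → suc j ≤ q → ∀ {D E} → (b j + 1ℚ) * D ≡ E → D ≡ c (suc j) * E
      solve-b j j<q {D} {E} eq = *-cancelˡ-inverse (b (suc j)) (b*c j j<q) (begin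
        b (suc j) * D                 ≡⟨ cong (_* D) (b-suc j) ⟩
        (b j + 1ℚ) * D                ≡⟨ eq ⟩
        E                             ≡⟨ ℚ.*-identityˡ E ⟨
        1ℚ * E                        ≡⟨ cong (_* E) (b*c j j<q) ⟨
        b (suc j) * c (suc j) * E     ≡⟨ ℚ.*-assoc (b (suc j)) (c (suc j)) E ⟩
        b (suc j) * (c (suc j) * E)   ∎)
        where open ≡-Reasoning

      binom-q : ∀ j → suc j ≤ q → binom (b j) q ≡ c (suc j) * (π * binom (b (suc j)) p)
      binom-q j j<q = solve-b j j<q (sym (trans (cong (λ s → π * binom s p) (b-suc j)) (binom-sucˡ (b j) q)))

      -- The residue of C(b, p) modulo p suffices: the factor π lifts it to p², where π t is x
      -- again.
      alternatingSum-step : ∀ j → suc j ≤ q →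
        alternatingSum q (b (suc j)) - alternatingSum q (b j) ≈ c (suc j) - x * (c (suc j) * c (suc j)) [ 2 ]
      alternatingSum-step j j<q = begin
        alternatingSum q (b (suc j)) - alternatingSum q (b j)
          ≡⟨ cong (λ s → alternatingSum q s - alternatingSum q (b j)) (b-suc j) ⟩
        alternatingSum q (b j + 1ℚ) - alternatingSum q (b j)
          ≡⟨ solve-b j j<q (alternatingSum-difference q (b j)) ⟩
        d * (1ℚ - sign q * binom (b j) q)
          ≡⟨ cong₂ (λ s u → d * (1ℚ - s * u)) sign-q (binom-q j j<q) ⟩
        d * (1ℚ - 1ℚ * (d * (π * binom (b (suc j)) p)))
          ≡⟨ rearrange d (π * binom (b (suc j)) p) ⟩
        d - (d * d) * (π * binom (b (suc j)) p)
          ≈⟨ ≈-- (≈-refl {x = d}) (≈-*ˡ (Int-* Id Id) (≈-scale V-π (binom-p (suc j) j<q It))) ⟩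
        d - (d * d) * x
          ≡⟨ cong (λ s → d - s) (ℚ.*-comm (d * d) x) ⟩
        d - x * (d * d) ∎
        where
        open SetoidReasoning (≈-setoid 2)
        d : ℚ
        d = c (suc j)
        Id : Int d
        Id = Ic j j<q
        rearrange : ∀ d w → d * (1ℚ - 1ℚ * (d * w)) ≡ d - (d * d) * w
        rearrange = solve-∀ ringℚ

      -- The weight 2 cancels the two 1/b contributions and leaves 2p/b² times the difference of the
      -- residues of C(b+h, p) and C(b, p). That difference is ε: 0 or 1 in the uses below.
      combinedSum-step : ∀ j {ε} → Int ε → suc j ≤ q → binom (x + ι (suc j ℕ.+ h)) p ≈ t + ε [ 1 ] →
        combinedSum (b (suc j)) - combinedSum (b j) ≈ (1ℚ + 1ℚ) * (π * (ε * (c (suc j) * c (suc j)))) [ 2 ]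
      combinedSum-step j {ε} Iε j<q carry = begin
        combinedSum (b (suc j)) - combinedSum (b j)
          ≡⟨ cong (λ s → combinedSum s - combinedSum (b j)) (b-suc j) ⟩
        combinedSum (b j + 1ℚ) - combinedSum (b j)
          ≡⟨ regroup (productSum h (b j + 1ℚ)) (productSum h (b j)) (alternatingSum q (b j + 1ℚ)) (alternatingSum q (b j)) ⟩
        (productSum h (b j + 1ℚ) - productSum h (b j)) + (1ℚ + 1ℚ) * (alternatingSum q (b j + 1ℚ) - alternatingSum q (b j))
          ≡⟨ cong₂ (λ s u → s + (1ℚ + 1ℚ) * u) (solve-b j j<q (productSum-difference h (b j))) (solve-b j j<q (alternatingSum-difference q (b j))) ⟩
        d * ((1ℚ + 1ℚ) * (G - 1ℚ)) + (1ℚ + 1ℚ) * (d * (1ℚ - sign q * binom (b j) q))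
          ≡⟨ cong₂ (λ s u → d * ((1ℚ + 1ℚ) * (s - 1ℚ)) + (1ℚ + 1ℚ) * (d * (1ℚ - u))) G≡ (cong₂ _*_ sign-q (binom-q j j<q)) ⟩
        d * ((1ℚ + 1ℚ) * (d * (π * (K * E)) - 1ℚ)) + (1ℚ + 1ℚ) * (d * (1ℚ - 1ℚ * (d * (π * W))))
          ≡⟨ simplify d π (K * E) W ⟩
        (1ℚ + 1ℚ) * ((d * d) * (π * (K * E - W)))
          ≈⟨ ≈-*ˡ (Int-ι 2) (≈-*ˡ (Int-* Id Id) (≈-scale V-π (≈-- K*E≈ (binom-p (suc j) j<q It)))) ⟩
        (1ℚ + 1ℚ) * ((d * d) * (π * (1ℚ * (t + ε) - t)))
          ≡⟨ finish d π t ε ⟩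
        (1ℚ + 1ℚ) * (π * (ε * (d * d))) ∎
        where
        open SetoidReasoning (≈-setoid 2)
        d G K E W : ℚ
        d = c (suc j)
        G = binom (b j) h * binom (- 1ℚ - (b j + 1ℚ)) h
        K = sign h * binom (ι q) h
        E = binom (x + ι (suc j ℕ.+ h)) p
        W = binom (b (suc j)) p
        Id : Int d
        Id = Ic j j<q
        V[q+1] : V 1 (ι q + 1ℚ)
        V[q+1] = subst (V 1) (ι-suc q) V-π
        -- K = (-1)^h C(p-1, h), and p - 1 ≡ -1 makes the binomial coefficient (-1)^h.
        K≈1 : K ≈ 1ℚ [ 1 ]
        K≈1 = ≈-trans (≈-*ˡ (Int-^ h (Int-fromℤ -[1+ 0 ])) (binom≈sign h h≤q V[q+1])) (≈-reflexive (sign*sign h))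
        K*E≈ : K * E ≈ 1ℚ * (t + ε) [ 1 ]
        K*E≈ = ≈-trans (≈-*ˡ (Int-* (Int-^ h (Int-fromℤ -[1+ 0 ])) (Int-binom h h≤q (Int-ι q))) carry)
          (≈-*ʳ (Int-+ It Iε) K≈1)
        arg : b j + 1ℚ + ι h ≡ x + ι (suc j ℕ.+ h)
        arg = trans (cong (λ s → s + ι h) (sym (b-suc j))) (trans (ℚ.+-assoc x (ι (suc j)) (ι h)) (cong (λ s → x + s) (sym (ι-+ (suc j) h))))
        G≡ : G ≡ d * (π * (K * E))
        G≡ = solve-b j j<q (trans (binom-central h (b j))
          (cong₂ (λ n s → ι (suc n) * (sign h * binom (ι n) h * binom s (suc n))) (sym q≡h+h) arg))
        regroup : ∀ f f′ a a′ → f + (1ℚ + 1ℚ) * a - (f′ + (1ℚ + 1ℚ) * a′) ≡ (f - f′) + (1ℚ + 1ℚ) * (a - a′)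
        regroup = solve-∀ ringℚ
        simplify : ∀ d π u W → d * ((1ℚ + 1ℚ) * (d * (π * u) - 1ℚ)) + (1ℚ + 1ℚ) * (d * (1ℚ - 1ℚ * (d * (π * W))))
          ≡ (1ℚ + 1ℚ) * ((d * d) * (π * (u - W)))
        simplify = solve-∀ ringℚ
        finish : ∀ d π t ε → (1ℚ + 1ℚ) * ((d * d) * (π * (1ℚ * (t + ε) - t))) ≡ (1ℚ + 1ℚ) * (π * (ε * (d * d)))
        finish = solve-∀ ringℚ

-- Bernoulli numbers and polynomials

sum0-cong : ∀ n {f g : ℕ → ℚ} → (∀ k → k ≤ n → f k ≡ g k) → sum0 n f ≡ sum0 n g
sum0-cong zero    eq = eq 0 z≤n
sum0-cong (suc n) eq = cong₂ _+_ (sum0-cong n (λ k k≤n → eq k (ℕ.m≤n⇒m≤1+n k≤n))) (eq (suc n) ℕ.≤-refl)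

sum0-+ : ∀ n (f g : ℕ → ℚ) → sum0 n (λ k → f k + g k) ≡ sum0 n f + sum0 n g
sum0-+ zero    f g = refl
sum0-+ (suc n) f g = trans (cong (_+ (f (suc n) + g (suc n))) (sum0-+ n f g))
  (+-interchange (sum0 n f) (sum0 n g) (f (suc n)) (g (suc n)))

sum0-*ˡ : ∀ n c (f : ℕ → ℚ) → sum0 n (λ k → c * f k) ≡ c * sum0 n f
sum0-*ˡ zero    c f = refl
sum0-*ˡ (suc n) c f = trans (cong (_+ c * f (suc n)) (sum0-*ˡ n c f))
  (sym (ℚ.*-distribˡ-+ c (sum0 n f) (f (suc n))))

sum0-suc : ∀ n (f : ℕ → ℚ) → sum0 (suc n) f ≡ f 0 + sum0 n (λ k → f (suc k))
sum0-suc zero    f = refl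
sum0-suc (suc n) f = trans (cong (_+ f (suc (suc n))) (sum0-suc n f))
  (ℚ.+-assoc (f 0) (sum0 n (λ k → f (suc k))) (f (suc (suc n))))

-- The umbral power (x + f)ⁿ, expanded by the binomial theorem with fᵏ read as f k.
appell : (ℕ → ℚ) → ℕ → ℚ → ℚ
appell f zero    x = f 0
appell f (suc n) x = x * appell f n x + appell (λ k → f (suc k)) n x

-- Pascal's rule is the umbral step (x + f)^(n+1) = x (x + f)^n + f (x + f)^n, where multiplication
-- by f shifts the sequence. From here on no sums of binomial products are needed for translations.
appell-sum : ∀ f n x → sum0 n (λ k → ι (n C k) * f k * (x ^ (n ∸ k))) ≡ appell f n x
appell-sum f zero    x = base (f 0)
  where
  base : ∀ a → 1ℚ * a * 1ℚ ≡ a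
  base = solve-∀ ringℚ
appell-sum f (suc n) x = begin
  sum0 (suc n) (λ k → ι (suc n C k) * f k * (x ^ (suc n ∸ k)))
    ≡⟨ sum0-suc n (λ k → ι (suc n C k) * f k * (x ^ (suc n ∸ k))) ⟩
  head + sum0 n (λ k → ι (suc n C suc k) * f (suc k) * (x ^ (n ∸ k)))
    ≡⟨ cong (λ s → head + s) (sum0-cong n (λ k _ → pascal k)) ⟩
  head + sum0 n (λ k → same k + next k)
    ≡⟨ cong (λ s → head + s) (sum0-+ n same next) ⟩
  head + (sum0 n same + sum0 n next)
    ≡⟨ swap head (sum0 n same) (sum0 n next) ⟩
  (head + sum0 n next) + sum0 n same
    ≡⟨ cong₂ _+_ (sum0-suc n (λ k → ι (n C k) * f k * (x ^ (suc n ∸ k)))) refl ⟨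
  sum0 n (λ k → ι (n C k) * f k * (x ^ (suc n ∸ k))) + ι (n C suc n) * f (suc n) * (x ^ (n ∸ n)) + sum0 n same
    -- The top term carries `n C suc n` = 0; it was added only so that `sum0-suc` could be used
    -- backwards.
    ≡⟨ cong₂ (λ s m → s + ι m * f (suc n) * (x ^ (n ∸ n)) + sum0 n same) (sum0-cong n pull) (k>n⇒nCk≡0 (ℕ.n<1+n n)) ⟩
  sum0 n (λ k → x * (ι (n C k) * f k * (x ^ (n ∸ k)))) + 0ℚ * f (suc n) * (x ^ (n ∸ n)) + sum0 n same
    ≡⟨ cong (_+ sum0 n same) (vanish (sum0 n (λ k → x * (ι (n C k) * f k * (x ^ (n ∸ k))))) (f (suc n)) (x ^ (n ∸ n))) ⟩
  sum0 n (λ k → x * (ι (n C k) * f k * (x ^ (n ∸ k)))) + sum0 n same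
    ≡⟨ cong (_+ sum0 n same) (sum0-*ˡ n x (λ k → ι (n C k) * f k * (x ^ (n ∸ k)))) ⟩
  x * sum0 n (λ k → ι (n C k) * f k * (x ^ (n ∸ k))) + sum0 n same
    ≡⟨ cong₂ (λ s u → x * s + u) (appell-sum f n x) (appell-sum (λ k → f (suc k)) n x) ⟩
  x * appell f n x + appell (λ k → f (suc k)) n x ∎
  where
  open ≡-Reasoning
  head : ℚ
  head = ι 1 * f 0 * (x ^ suc n)
  same next : ℕ → ℚ
  same k = ι (n C k) * f (suc k) * (x ^ (n ∸ k))
  next k = ι (n C suc k) * f (suc k) * (x ^ (n ∸ k))
  distrib : ∀ a b c d → (a + b) * c * d ≡ a * c * d + b * c * d
  distrib = solve-∀ ringℚ
  pascal : ∀ k → ι (suc n C suc k) * f (suc k) * (x ^ (n ∸ k)) ≡ same k + next k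
  pascal k = trans (cong (λ m → m * f (suc k) * (x ^ (n ∸ k)))
      (trans (cong ι (sym (nCk+nC[k+1]≡[n+1]C[k+1] n k))) (ι-+ (n C k) (n C suc k))))
    (distrib (ι (n C k)) (ι (n C suc k)) (f (suc k)) (x ^ (n ∸ k)))
  swap : ∀ a b c → a + (b + c) ≡ a + c + b
  swap = solve-∀ ringℚ
  move : ∀ a b x c → a * b * (x * c) ≡ x * (a * b * c)
  move = solve-∀ ringℚ
  pull : ∀ k → k ≤ n → ι (n C k) * f k * (x ^ (suc n ∸ k)) ≡ x * (ι (n C k) * f k * (x ^ (n ∸ k)))
  pull k k≤n = trans (cong (λ e → ι (n C k) * f k * (x ^ e)) (ℕ.+-∸-assoc 1 k≤n))
    (move (ι (n C k)) (f k) x (x ^ (n ∸ k)))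
  vanish : ∀ s a b → s + 0ℚ * a * b ≡ s
  vanish = solve-∀ ringℚ

appell-cong : ∀ {f g} → (∀ k → f k ≡ g k) → ∀ n x → appell f n x ≡ appell g n x
appell-cong eq zero    x = eq 0
appell-cong eq (suc n) x = cong₂ (λ s u → x * s + u) (appell-cong eq n x) (appell-cong (λ k → eq (suc k)) n x)

appell-linear : ∀ c (f g : ℕ → ℚ) n x → appell (λ k → c * f k + g k) n x ≡ c * appell f n x + appell g n x
appell-linear c f g zero    x = refl
appell-linear c f g (suc n) x = trans
  (cong₂ (λ s u → x * s + u) (appell-linear c f g n x) (appell-linear c (λ k → f (suc k)) (λ k → g (suc k)) n x))
  (rearrange x c (appell f n x) (appell g n x) (appell (λ k → f (suc k)) n x) (appell (λ k → g (suc k)) n x))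
  where
  rearrange : ∀ x c a b a′ b′ → x * (c * a + b) + (c * a′ + b′) ≡ c * (x * a + a′) + (x * b + b′)
  rearrange = solve-∀ ringℚ

appell-+ : ∀ (f g : ℕ → ℚ) n x → appell (λ k → f k + g k) n x ≡ appell f n x + appell g n x
appell-+ f g n x = trans (appell-cong (λ k → cong (_+ g k) (sym (ℚ.*-identityˡ (f k)))) n x)
  (trans (appell-linear 1ℚ f g n x) (cong (_+ appell g n x) (ℚ.*-identityˡ (appell f n x))))

-- Umbrally, (f + x) + y = f + (x + y).
appell-translate : ∀ f n x y → appell (λ k → appell f k x) n y ≡ appell f n (x + y)
appell-translate f zero    x y = refl
appell-translate f (suc n) x y = begin
  y * appell (λ k → appell f k x) n y + appell (λ k → x * appell f k x + appell f′ k x) n y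
    ≡⟨ cong (λ s → y * appell (λ k → appell f k x) n y + s) (appell-linear x (λ k → appell f k x) (λ k → appell f′ k x) n y) ⟩
  y * appell (λ k → appell f k x) n y + (x * appell (λ k → appell f k x) n y + appell (λ k → appell f′ k x) n y)
    ≡⟨ cong₂ (λ s u → y * s + (x * s + u)) (appell-translate f n x y) (appell-translate f′ n x y) ⟩
  y * appell f n (x + y) + (x * appell f n (x + y) + appell f′ n (x + y))
    ≡⟨ rearrange x y (appell f n (x + y)) (appell f′ n (x + y)) ⟩
  (x + y) * appell f n (x + y) + appell f′ n (x + y) ∎
  where
  open ≡-Reasoning
  f′ : ℕ → ℚ
  f′ k = f (suc k)
  rearrange : ∀ x y a b → y * a + (x * a + b) ≡ (x + y) * a + b
  rearrange = solve-∀ ringℚ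

appell-0 : ∀ f n → appell f n 0ℚ ≡ f n
appell-0 f zero    = refl
appell-0 f (suc n) = trans (drop (appell f n 0ℚ) (appell (λ k → f (suc k)) n 0ℚ)) (appell-0 (λ k → f (suc k)) n)
  where
  drop : ∀ a b → 0ℚ * a + b ≡ b
  drop = solve-∀ ringℚ

appell-zero : ∀ n x → appell (λ _ → 0ℚ) n x ≡ 0ℚ
appell-zero zero    x = refl
appell-zero (suc n) x = trans (cong₂ (λ s u → x * s + u) (appell-zero n x) (appell-zero n x)) (absorb x)
  where
  absorb : ∀ x → x * 0ℚ + 0ℚ ≡ 0ℚ
  absorb = solve-∀ ringℚ

-- Umbrally, (x - f)^n = (-1)^n (- x + f)^n.
appell-sign : ∀ f n x → appell (λ k → sign k * f k) n x ≡ sign n * appell f n (- x)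
appell-sign f zero    x = refl
appell-sign f (suc n) x = begin
  x * appell (λ k → sign k * f k) n x + appell (λ k → - 1ℚ * sign k * f (suc k)) n x
    ≡⟨ cong (λ s → x * appell (λ k → sign k * f k) n x + s) (appell-cong (λ k → pad (sign k) (f (suc k))) n x) ⟩
  x * appell (λ k → sign k * f k) n x + appell (λ k → - 1ℚ * (sign k * f (suc k)) + 0ℚ) n x
    ≡⟨ cong (λ s → x * appell (λ k → sign k * f k) n x + s) (appell-linear (- 1ℚ) (λ k → sign k * f (suc k)) (λ _ → 0ℚ) n x) ⟩
  x * appell (λ k → sign k * f k) n x + (- 1ℚ * appell (λ k → sign k * f (suc k)) n x + appell (λ _ → 0ℚ) n x)
    ≡⟨ cong₂ (λ s u → x * s + (- 1ℚ * u + appell (λ _ → 0ℚ) n x)) (appell-sign f n x) (appell-sign (λ k → f (suc k)) n x) ⟩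
  x * (sign n * appell f n (- x)) + (- 1ℚ * (sign n * appell (λ k → f (suc k)) n (- x)) + appell (λ _ → 0ℚ) n x)
    ≡⟨ cong (λ s → x * (sign n * appell f n (- x)) + (- 1ℚ * (sign n * appell (λ k → f (suc k)) n (- x)) + s)) (appell-zero n x) ⟩
  x * (sign n * appell f n (- x)) + (- 1ℚ * (sign n * appell (λ k → f (suc k)) n (- x)) + 0ℚ)
    ≡⟨ rearrange x (sign n) (appell f n (- x)) (appell (λ k → f (suc k)) n (- x)) ⟩
  - 1ℚ * sign n * (- x * appell f n (- x) + appell (λ k → f (suc k)) n (- x)) ∎
  where
  open ≡-Reasoning
  pad : ∀ e a → - 1ℚ * e * a ≡ - 1ℚ * (e * a) + 0ℚ
  pad = solve-∀ ringℚ
  rearrange : ∀ x e a b → x * (e * a) + (- 1ℚ * (e * b) + 0ℚ) ≡ - 1ℚ * e * (- x * a + b)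
  rearrange = solve-∀ ringℚ

-- As umbral sequences these give x^n and its derivative n x^(n-1). `δ₁` is also the defect of the
-- Bernoulli identity (1 + B)^n = B^n, which fails only at n = 1.
δ₀ δ₁ : ℕ → ℚ
δ₀ zero    = 1ℚ
δ₀ (suc k) = 0ℚ
δ₁ zero    = 0ℚ
δ₁ (suc k) = δ₀ k

appell-δ₀ : ∀ n x → appell δ₀ n x ≡ x ^ n
appell-δ₀ zero    x = refl
appell-δ₀ (suc n) x = trans (cong₂ (λ s u → x * s + u) (appell-δ₀ n x) (appell-zero n x))
  (ℚ.+-identityʳ (x * (x ^ n)))

appell-δ₁ : ∀ n x → appell δ₁ (suc n) x ≡ ι (suc n) * (x ^ n)
appell-δ₁ zero    x = base x
  where
  base : ∀ x → x * 0ℚ + 1ℚ ≡ 1ℚ * 1ℚ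
  base = solve-∀ ringℚ
appell-δ₁ (suc n) x = begin
  x * appell δ₁ (suc n) x + appell δ₀ (suc n) x   ≡⟨ cong₂ (λ s u → x * s + u) (appell-δ₁ n x) (appell-δ₀ (suc n) x) ⟩
  x * (ι (suc n) * (x ^ n)) + x * (x ^ n)         ≡⟨ rearrange x (ι (suc n)) (x ^ n) ⟩
  (ι (suc n) + 1ℚ) * (x * (x ^ n))                ≡⟨ cong (_* (x * (x ^ n))) (ι-suc (suc n)) ⟨
  ι (suc (suc n)) * (x * (x ^ n))                 ∎
  where
  open ≡-Reasoning
  rearrange : ∀ x m y → x * (m * y) + x * y ≡ (m + 1ℚ) * (x * y)
  rearrange = solve-∀ ringℚ

bernTable-B : ∀ n k → k ≤ n → bernTable n k ≡ B k
bernTable-B zero    zero z≤n = refl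
bernTable-B (suc n) k k≤1+n with k ℕ.≤? n
... | yes k≤n = bernTable-B n k k≤n
... | no  k≰n with ℕ.≤-antisym k≤1+n (ℕ.≰⇒> k≰n)
...   | refl with suc n ℕ.≤? n
...     | yes 1+n≤n = contradiction 1+n≤n k≰n
...     | no  _     = refl

B-suc : ∀ n → B (suc n) ≡ - (recip (suc (suc n)) * sum0 n (λ j → ι (suc (suc n) C j) * B j))
B-suc n with suc n ℕ.≤? n
... | yes 1+n≤n = contradiction 1+n≤n (ℕ.n≮n n)
... | no  _     = cong (λ s → - (recip (suc (suc n)) * s))
  (sum0-cong n (λ j j≤n → cong (ι (suc (suc n) C j) *_) (bernTable-B n j j≤n)))

sucnCn≡sucn : ∀ n → suc n C n ≡ suc n
sucnCn≡sucn n = trans (nCk≡nC[n∸k] (ℕ.n≤1+n n)) (trans (cong (suc n C_) (ℕ.m+n∸n≡m 1 n)) (nC1≡n (suc n)))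

B-recurrence : ∀ n → sum0 (suc n) (λ k → ι (suc (suc n) C k) * B k) ≡ 0ℚ
B-recurrence n = begin
  Σ + ι (suc (suc n) C suc n) * B (suc n)   ≡⟨ cong₂ (λ m s → Σ + ι m * s) (sucnCn≡sucn (suc n)) (B-suc n) ⟩
  Σ + ι (suc (suc n)) * - (recip (suc (suc n)) * Σ) ≡⟨ rearrange Σ (ι (suc (suc n))) (recip (suc (suc n))) ⟩
  Σ - (ι (suc (suc n)) * recip (suc (suc n))) * Σ   ≡⟨ cong (λ s → Σ - s * Σ) (recip-inverseʳ (suc n)) ⟩
  Σ - 1ℚ * Σ                                ≡⟨ cancel Σ ⟩
  0ℚ                                        ∎
  where
  open ≡-Reasoning
  Σ : ℚ
  Σ = sum0 n (λ k → ι (suc (suc n) C k) * B k)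
  rearrange : ∀ s m r → s + m * - (r * s) ≡ s - (m * r) * s
  rearrange = solve-∀ ringℚ
  cancel : ∀ s → s - 1ℚ * s ≡ 0ℚ
  cancel = solve-∀ ringℚ

appell-1 : ∀ f n → appell f n 1ℚ ≡ sum0 n (λ k → ι (n C k) * f k)
appell-1 f n = trans (sym (appell-sum f n 1ℚ)) (sum0-cong n (λ k _ →
  trans (cong (ι (n C k) * f k *_) (1^n≡1 (n ∸ k))) (ℚ.*-identityʳ (ι (n C k) * f k))))

-- The defining recurrence in umbral form. It starts at n = 2; the cases 0 and 1 hold by
-- computation.
appell-B-1 : ∀ n → appell B n 1ℚ ≡ B n + δ₁ n
appell-B-1 zero          = refl
appell-B-1 (suc zero)    = refl
appell-B-1 (suc (suc n)) = begin
  appell B (suc (suc n)) 1ℚ                            ≡⟨ appell-1 B (suc (suc n)) ⟩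
  sum0 (suc n) (λ k → ι (suc (suc n) C k) * B k) + ι (suc (suc n) C suc (suc n)) * B (suc (suc n))
    ≡⟨ cong₂ (λ s m → s + ι m * B (suc (suc n))) (B-recurrence n) (nCn≡1 (suc (suc n))) ⟩
  0ℚ + 1ℚ * B (suc (suc n))                            ≡⟨ rearrange (B (suc (suc n))) ⟩
  B (suc (suc n)) + 0ℚ                                 ∎
  where
  open ≡-Reasoning
  rearrange : ∀ b → 0ℚ + 1ℚ * b ≡ b + 0ℚ
  rearrange = solve-∀ ringℚ

Bpoly≡appell : ∀ n x → Bpoly n x ≡ appell B n x
Bpoly≡appell n x = appell-sum B n x

-- Translate `appell-B-1` by x: the difference equation at 0 for all degrees implies it everywhere.
appell-B-difference : ∀ n x → appell B n (1ℚ + x) ≡ appell B n x + appell δ₁ n x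
appell-B-difference n x = begin
  appell B n (1ℚ + x)                       ≡⟨ appell-translate B n 1ℚ x ⟨
  appell (λ k → appell B k 1ℚ) n x          ≡⟨ appell-cong appell-B-1 n x ⟩
  appell (λ k → B k + δ₁ k) n x             ≡⟨ appell-+ B δ₁ n x ⟩
  appell B n x + appell δ₁ n x              ∎
  where open ≡-Reasoning

Bpoly-difference : ∀ n x → Bpoly (suc n) (1ℚ + x) ≡ Bpoly (suc n) x + ι (suc n) * (x ^ n)
Bpoly-difference n x = begin
  Bpoly (suc n) (1ℚ + x)                       ≡⟨ Bpoly≡appell (suc n) (1ℚ + x) ⟩
  appell B (suc n) (1ℚ + x)                    ≡⟨ appell-B-difference (suc n) x ⟩
  appell B (suc n) x + appell δ₁ (suc n) x     ≡⟨ cong₂ _+_ (sym (Bpoly≡appell (suc n) x)) (appell-δ₁ n x) ⟩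
  Bpoly (suc n) x + ι (suc n) * (x ^ n)        ∎
  where open ≡-Reasoning

sum0-last : ∀ n (f : ℕ → ℚ) → (∀ k → k < n → f k ≡ 0ℚ) → sum0 n f ≡ f n
sum0-last zero    f z = refl
sum0-last (suc n) f z = trans (cong (_+ f (suc n)) (trans (sum0-last n f (λ k k<n → z k (ℕ.m<n⇒m<1+n k<n))) (z n ℕ.≤-refl)))
  (ℚ.+-identityˡ (f (suc n)))

-- Uniqueness for the Bernoulli recurrence: being fixed in degree n + 1 says Σ C(n+1, k) f k = 0
-- over k ≤ n, and once the earlier values vanish only (n + 1) f n remains.
appell-fixed⇒0 : ∀ f → (∀ n → appell f n 1ℚ ≡ f n) → ∀ n → f n ≡ 0ℚ
appell-fixed⇒0 f fixed n = below (suc n) n ℕ.≤-refl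
  where
  open ≡-Reasoning
  drop : ∀ s a → s ≡ s + 1ℚ * a - a
  drop = solve-∀ ringℚ
  step : ∀ n → (∀ k → k < n → f k ≡ 0ℚ) → f n ≡ 0ℚ
  step n f≡0 = ι-cancelˡ n (begin
    ι (suc n) * f n                     ≡⟨ cong (λ m → ι m * f n) (sucnCn≡sucn n) ⟨
    ι (suc n C n) * f n                 ≡⟨ sum0-last n (λ k → ι (suc n C k) * f k) (λ k k<n → trans (cong (ι (suc n C k) *_) (f≡0 k k<n)) (ℚ.*-zeroʳ (ι (suc n C k)))) ⟨
    Σ                                   ≡⟨ drop Σ (f (suc n)) ⟩
    Σ + 1ℚ * f (suc n) - f (suc n)      ≡⟨ cong (λ m → Σ + ι m * f (suc n) - f (suc n)) (nCn≡1 (suc n)) ⟨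
    Σ + ι (suc n C suc n) * f (suc n) - f (suc n) ≡⟨ cong (_- f (suc n)) (trans (sym (appell-1 f (suc n))) (fixed (suc n))) ⟩
    f (suc n) - f (suc n)               ≡⟨ ℚ.+-inverseʳ (f (suc n)) ⟩
    0ℚ                                  ≡⟨ ℚ.*-zeroʳ (ι (suc n)) ⟨
    ι (suc n) * 0ℚ                      ∎)
    where
    Σ : ℚ
    Σ = sum0 n (λ k → ι (suc n C k) * f k)
  below : ∀ n k → k < n → f k ≡ 0ℚ
  below (suc n) k (s≤s k≤n) = step k (λ j j<k → below n j (ℕ.<-≤-trans j<k k≤n))

-- The sequence (-1)ᵏ B k solves the Bernoulli recurrence except at k = 1.
B-sign : ∀ n → sign n * B n ≡ B n + δ₁ n
B-sign n = difference (sign n * B n) (B n) (δ₁ n) (appell-fixed⇒0 D D-fixed n)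
  where
  open ≡-Reasoning
  difference : ∀ a b c → - 1ℚ * (b + c) + a ≡ 0ℚ → a ≡ b + c
  difference a b c eq = trans (split a b c) (trans (cong (λ s → b + c + s) eq) (ℚ.+-identityʳ (b + c)))
    where
    split : ∀ a b c → a ≡ b + c + (- 1ℚ * (b + c) + a)
    split = solve-∀ ringℚ
  -- Translation by 1 adds the same `appell δ₁ n 1ℚ` to B k + δ₁ k and to (-1)^k B k, so their
  -- difference is fixed by it.
  D : ℕ → ℚ
  D k = - 1ℚ * (B k + δ₁ k) + sign k * B k
  reflect : ∀ n → sign n * appell B n (- 1ℚ) ≡ sign n * B n + appell δ₁ n 1ℚ
  reflect n = begin
    sign n * appell B n (- 1ℚ)                   ≡⟨ expand (sign n) (appell B n (- 1ℚ)) (appell δ₁ n (- 1ℚ)) ⟩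
    sign n * (appell B n (- 1ℚ) + appell δ₁ n (- 1ℚ)) - sign n * appell δ₁ n (- 1ℚ)
      ≡⟨ cong₂ (λ s u → sign n * s - u) (trans (sym (appell-B-difference n (- 1ℚ))) (appell-0 B n)) (sym (appell-sign δ₁ n 1ℚ)) ⟩
    sign n * B n - appell (λ k → sign k * δ₁ k) n 1ℚ
      ≡⟨ cong (λ s → sign n * B n - s) (trans (appell-cong sign-δ₁ n 1ℚ) (appell-linear (- 1ℚ) δ₁ (λ _ → 0ℚ) n 1ℚ)) ⟩
    sign n * B n - (- 1ℚ * appell δ₁ n 1ℚ + appell (λ _ → 0ℚ) n 1ℚ)
      ≡⟨ cong (λ s → sign n * B n - (- 1ℚ * appell δ₁ n 1ℚ + s)) (appell-zero n 1ℚ) ⟩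
    sign n * B n - (- 1ℚ * appell δ₁ n 1ℚ + 0ℚ)
      ≡⟨ clean (sign n * B n) (appell δ₁ n 1ℚ) ⟩
    sign n * B n + appell δ₁ n 1ℚ ∎
    where
    expand : ∀ e a b → e * a ≡ e * (a + b) - e * b
    expand = solve-∀ ringℚ
    clean : ∀ a b → a - (- 1ℚ * b + 0ℚ) ≡ a + b
    clean = solve-∀ ringℚ
    sign-δ₁ : ∀ k → sign k * δ₁ k ≡ - 1ℚ * δ₁ k + 0ℚ
    sign-δ₁ zero          = refl
    sign-δ₁ (suc zero)    = refl
    sign-δ₁ (suc (suc k)) = ℚ.*-zeroʳ (sign (suc (suc k)))
  D-fixed : ∀ n → appell D n 1ℚ ≡ D n
  D-fixed n = begin
    appell D n 1ℚ
      ≡⟨ appell-linear (- 1ℚ) (λ k → B k + δ₁ k) (λ k → sign k * B k) n 1ℚ ⟩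
    - 1ℚ * appell (λ k → B k + δ₁ k) n 1ℚ + appell (λ k → sign k * B k) n 1ℚ
      ≡⟨ cong₂ (λ s u → - 1ℚ * s + u) (trans (appell-+ B δ₁ n 1ℚ) (cong (_+ appell δ₁ n 1ℚ) (appell-B-1 n))) (trans (appell-sign B n 1ℚ) (reflect n)) ⟩
    - 1ℚ * (B n + δ₁ n + appell δ₁ n 1ℚ) + (sign n * B n + appell δ₁ n 1ℚ)
      ≡⟨ cancel (B n + δ₁ n) (appell δ₁ n 1ℚ) (sign n * B n) ⟩
    - 1ℚ * (B n + δ₁ n) + sign n * B n ∎
    where
    cancel : ∀ a b c → - 1ℚ * (a + b) + (c + b) ≡ - 1ℚ * a + c
    cancel = solve-∀ ringℚ

-- The index 2m + 3 is odd and avoids 1, where `δ₁` would intervene, so `B-sign` reads - B = B.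
B-odd : ∀ m → B (suc (suc m ℕ.+ suc m)) ≡ 0ℚ
B-odd m = *-cancelˡ-inverse (1ℚ + 1ℚ) {v = recip 2} refl (begin
  (1ℚ + 1ℚ) * β                     ≡⟨ double β ⟩
  β + 0ℚ - - 1ℚ * 1ℚ * β            ≡⟨ cong (λ s → β + 0ℚ - - 1ℚ * s * β) (sign-even (suc m)) ⟨
  β + 0ℚ - sign n * β               ≡⟨ cong (_- sign n * β) (cong (λ s → β + s) (sym (δ₀-pos m))) ⟩
  β + δ₁ n - sign n * β             ≡⟨ cong (_- sign n * β) (B-sign n) ⟨
  sign n * β - sign n * β           ≡⟨ ℚ.+-inverseʳ (sign n * β) ⟩
  0ℚ                                ∎)
  where
  open ≡-Reasoning
  n : ℕ
  n = suc (suc m ℕ.+ suc m)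
  β : ℚ
  β = B n
  δ₀-pos : ∀ m → δ₀ (suc m ℕ.+ suc m) ≡ 0ℚ
  δ₀-pos m = refl
  double : ∀ b → (1ℚ + 1ℚ) * b ≡ b + 0ℚ - - 1ℚ * 1ℚ * b
  double = solve-∀ ringℚ

-- Integrality of Bernoulli numbers at p

nCk*[k!*[n∸k]!]≡n! : ∀ {n k} → k ≤ n → (n C k) ℕ.* (k ! ℕ.* (n ∸ k) !) ≡ n !
nCk*[k!*[n∸k]!]≡n! {n} {k} k≤n = trans (cong (ℕ._* (k ! ℕ.* (n ∸ k) !)) (nCk≡n!/k![n-k]! k≤n))
  (ℕ.m/n*n≡m (k![n∸k]!∣n! k≤n))
  where instance _ = k ℕ.!* (n ∸ k) !≢0

module PrimeBinomials (q : ℕ) (p-prime : Prime (suc q)) where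

  open Binomials q p-prime

  private
    p : ℕ
    p = suc q

  p∤! : ∀ n → n ≤ q → ¬ p ∣ n !
  p∤! zero    n≤q = p∤1
  p∤! (suc n) n<q = p∤* (p∤suc (s≤s n<q)) (p∤! n (ℕ.<⇒≤ n<q))

  -- p divides n! but neither k! nor (n - k)!.
  p∣C : ∀ n k → k ≤ n → p ≤ n → k ≤ q → n ∸ k ≤ q → p ∣ n C k
  p∣C n k k≤n p≤n k≤q n-k≤q =
    [ (λ p∣C → p∣C) , (λ p∣!! → contradiction p∣!! (p∤* (p∤! k k≤q) (p∤! (n ∸ k) n-k≤q))) ]′
    (euclidsLemma (n C k) (k ! ℕ.* (n ∸ k) !) p-prime
      (subst (p ∣_) (sym (nCk*[k!*[n∸k]!]≡n! k≤n)) (ℕ.∣-trans (ℕ.m∣m*n (q !)) (ℕ.m≤n⇒m!∣n! p≤n))))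

  V-C : ∀ n k → k ≤ n → p ≤ n → k ≤ q → n ∸ k ≤ q → V 1 (ι (n C k))
  V-C n k k≤n p≤n k≤q n-k≤q = V-∣ (p∣C n k k≤n p≤n k≤q n-k≤q)

  -- The binomial theorem is the umbral expansion of the constant sequence 1; p divides its inner
  -- coefficients C(p, k).
  frobenius : ∀ {x} → Int x → (x + 1ℚ) ^ p ≈ (x ^ p) + 1ℚ [ 1 ]
  frobenius {x} Ix = begin
    (x + 1ℚ) ^ p               ≡⟨ appell-const p ⟨
    appell (λ _ → 1ℚ) p x      ≡⟨ appell-sum (λ _ → 1ℚ) p x ⟨
    sum0 q term + term p       ≈⟨ ≈-+ (middle q ℕ.≤-refl) (≈-reflexive top) ⟩
    (x ^ p) + 1ℚ               ∎
    where
    open SetoidReasoning (≈-setoid 1)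
    term : ℕ → ℚ
    term k = ι (p C k) * 1ℚ * (x ^ (p ∸ k))
    appell-const : ∀ n → appell (λ _ → 1ℚ) n x ≡ (x + 1ℚ) ^ n
    appell-const zero    = refl
    appell-const (suc n) = trans (merge x (appell (λ _ → 1ℚ) n x)) (cong ((x + 1ℚ) *_) (appell-const n))
      where
      merge : ∀ x a → x * a + a ≡ (x + 1ℚ) * a
      merge = solve-∀ ringℚ
    V-term : ∀ k → suc k ≤ q → V 1 (term (suc k))
    V-term k k<q = V-*ʳ (V-*ʳ (V-C p (suc k) (ℕ.m≤n⇒m≤1+n k<q) ℕ.≤-refl k<q (ℕ.m∸n≤m q k)) (Int-ι 1)) (Int-^ (q ∸ k) Ix)
    middle : ∀ n → n ≤ q → sum0 n term ≈ x ^ p [ 1 ]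
    middle zero    n≤q = ≈-reflexive (unit (x ^ p))
      where
      unit : ∀ a → 1ℚ * 1ℚ * a ≡ a
      unit = solve-∀ ringℚ
    middle (suc n) n<q = ≈-trans (≈-+ (middle n (ℕ.<⇒≤ n<q)) (V⇒≈0 (V-term n n<q))) (≈-reflexive (ℚ.+-identityʳ (x ^ p)))
    top : term p ≡ 1ℚ
    top = cong₂ (λ c e → ι c * 1ℚ * (x ^ e)) (nCn≡1 p) (ℕ.n∸n≡0 p)

module BernoulliIntegrality (q₂ : ℕ) (p-prime : Prime (suc (suc (suc q₂)))) where

  private
    -- q, q₁, q₂ are p - 1, p - 2, p - 3; building p upwards from q₂ avoids truncated subtraction.
    q₁ q p : ℕ
    q₁ = suc q₂
    q  = suc q₁
    p  = suc q

  open Binomials q p-prime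
  open PrimeBinomials q p-prime

  Int-B-suc : ∀ k → ¬ p ∣ suc (suc k) → (∀ j → j ≤ k → Int (ι (suc (suc k) C j) * B j)) → Int (B (suc k))
  Int-B-suc k p∤ h = subst Int (sym (B-suc k)) (Int-neg (Int-* (Int-recip p∤) (Int-sum0 k h)))

  -- The recurrence for B k divides by k + 1, which is prime to p as long as k ≤ p - 2. The argument
  -- n only bounds the strong induction.
  Int-B-small : ∀ n k → k < n → k ≤ q₁ → Int (B k)
  Int-B-small (suc n) zero    k<n       k≤q₁ = Int-ι 1
  Int-B-small (suc n) (suc k) (s≤s k<n) k<q₁ = Int-B-suc k (p∤suc (s≤s (s≤s k<q₁)))
    (λ j j≤k → Int-* (Int-ι (suc (suc k) C j)) (Int-B-small n j (ℕ.≤-<-trans j≤k k<n) (ℕ.≤-trans j≤k (ℕ.<⇒≤ k<q₁))))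

  -- For B_(p-1) the recurrence divides by p itself, once, and all earlier terms are integral.
  Int-π*B-q : Int (π * B q)
  Int-π*B-q = subst Int eq (Int-neg (Int-sum0 q₁ {f} (λ j j≤q₁ → Int-* (Int-ι (p C j)) (Int-B-small (suc j) j ℕ.≤-refl j≤q₁))))
    where
    open ≡-Reasoning
    f : ℕ → ℚ
    f j = ι (p C j) * B j
    unit : ∀ s → - s ≡ - (1ℚ * s)
    unit = solve-∀ ringℚ
    assoc : ∀ a b s → - (a * b * s) ≡ a * - (b * s)
    assoc = solve-∀ ringℚ
    eq : - sum0 q₁ f ≡ π * B q
    eq = begin
      - sum0 q₁ f                       ≡⟨ unit (sum0 q₁ f) ⟩
      - (1ℚ * sum0 q₁ f)                ≡⟨ cong (λ s → - (s * sum0 q₁ f)) (recip-inverseʳ q) ⟨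
      - (π * recip p * sum0 q₁ f)       ≡⟨ assoc π (recip p) (sum0 q₁ f) ⟩
      π * - (recip p * sum0 q₁ f)       ≡⟨ cong (π *_) (B-suc q₁) ⟨
      π * B q                           ∎


  -- The recurrence for B_(p+s) divides by N = p + s + 1, which is prime to p. The only term in
  -- doubt is that of B_(p-1), whose coefficient C(N, p-1) is divisible by p and cancels the
  -- denominator.
  Int-B-beyond : ∀ n s → s < n → s < q₁ → Int (B (p ℕ.+ s))
  Int-B-beyond (suc n) s (s≤s s≤n) s<q₁ = Int-B-suc (q ℕ.+ s) p∤ integral
    where
    p∤ : ¬ p ∣ suc (suc (q ℕ.+ s))
    p∤ p∣ = p∤suc {s} (s≤s (ℕ.m≤n⇒m≤1+n s<q₁))
      (ℕ.∣m+n∣m⇒∣n (subst (p ∣_) (cong suc (sym (ℕ.+-suc q s))) p∣) ℕ.∣-refl)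
    N : ℕ
    N = suc (suc (q ℕ.+ s))
    p≤N : p ≤ N
    p≤N = s≤s (ℕ.m≤n⇒m≤1+n (ℕ.m≤m+n q s))
    N∸q≤q : N ∸ q ≤ q
    N∸q≤q = subst (_≤ q) (sym (trans (cong (_∸ q) (trans (cong suc (sym (ℕ.+-suc q s))) (sym (ℕ.+-suc q (suc s))))) (ℕ.m+n∸m≡n q (suc (suc s))))) (s≤s s<q₁)
    term : ℕ → ℚ
    term j = ι (N C j) * B j
    at-q : Int (ι (N C q) * B q)
    at-q = divide (V-C N q (ℕ.≤-trans (ℕ.n≤1+n q) p≤N) p≤N ℕ.≤-refl N∸q≤q)
      where
      swap : ∀ a b c → a * b * c ≡ b * (a * c)
      swap = solve-∀ ringℚ
      divide : ∀ {y} → V 1 y → Int (y * B q)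
      divide {y} (mkV z Iz y≡) = subst Int
        (sym (trans (cong (_* B q) (trans y≡ (cong (_* z) p^1≡π))) (swap π z (B q))))
        (Int-* Iz Int-π*B-q)
    integral : ∀ j → j ≤ q ℕ.+ s → Int (term j)
    integral j j≤ = [ low , [ mid , high ]′ ]′ (compare j)
      where
      compare : ∀ j → j < q ⊎ (j ≡ q ⊎ q < j)
      compare j with ℕ.<-cmp j q
      ... | tri< j<q _ _ = inj₁ j<q
      ... | tri≈ _ j≡q _ = inj₂ (inj₁ j≡q)
      ... | tri> _ _ q<j = inj₂ (inj₂ q<j)
      low : j < q → Int (term j)
      low (s≤s j≤q₁) = Int-* (Int-ι (N C j)) (Int-B-small (suc j) j ℕ.≤-refl j≤q₁)
      mid : j ≡ q → Int (term j)
      mid j≡q = subst (λ i → Int (term i)) (sym j≡q) at-q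
      high : q < j → Int (term j)
      high q<j = Int-* (Int-ι (N C j)) (subst (λ i → Int (B i)) (ℕ.m+[n∸m]≡n q<j)
        (Int-B-beyond n (j ∸ p) (ℕ.<-≤-trans j∸p<s s≤n) (ℕ.<-trans j∸p<s s<q₁)))
        where
        j∸p<s : j ∸ p < s
        j∸p<s = ℕ.+-cancelˡ-≤ q (suc (j ∸ p)) s (subst (_≤ q ℕ.+ s) (trans (sym (ℕ.m+[n∸m]≡n q<j)) (sym (ℕ.+-suc q (j ∸ p)))) j≤)

  Int-B : ∀ k → k < q ℕ.+ q → k ≢ q → Int (B k)
  Int-B k k<2q k≢q = [ small , beyond ]′ (ℕ.≤-<-connex k q₁)
    where
    small : k ≤ q₁ → Int (B k)
    small = Int-B-small (suc k) k ℕ.≤-refl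
    beyond : q ≤ k → Int (B k)
    beyond q≤k = subst (λ i → Int (B i)) (ℕ.m+[n∸m]≡n q<k) (Int-B-beyond (suc (k ∸ p)) (k ∸ p) ℕ.≤-refl
      (ℕ.+-cancelˡ-< q (k ∸ p) q₁ (ℕ.s≤s⁻¹ (subst₂ _≤_ (cong suc (sym (ℕ.m+[n∸m]≡n q<k))) (ℕ.+-suc q q₁) k<2q))))
      where
      q<k : q < k
      q<k = ℕ.≤∧≢⇒< q≤k (λ q≡k → k≢q (sym q≡k))

  V-^ : ∀ {x} n → V 1 x → V n (x ^ n)
  V-^ zero    Vx = Int⇒V0 (Int-ι 1)
  V-^ (suc n) Vx = V-*-V Vx (V-^ n Vx)

  Bpoly-constant : ∀ n x →
    Bpoly (suc n) x - B (suc n) ≡ sum0 n (λ k → ι (suc n C k) * B k * (x ^ (suc n ∸ k)))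
  Bpoly-constant n x = begin
    Σ + ι (suc n C suc n) * B (suc n) * (x ^ (n ∸ n)) - B (suc n)
      ≡⟨ cong₂ (λ m e → Σ + ι m * B (suc n) * (x ^ e) - B (suc n)) (nCn≡1 (suc n)) (ℕ.n∸n≡0 n) ⟩
    Σ + 1ℚ * B (suc n) * 1ℚ - B (suc n)  ≡⟨ cancel Σ (B (suc n)) ⟩
    Σ                                    ∎
    where
    open ≡-Reasoning
    Σ : ℚ
    Σ = sum0 n (λ k → ι (suc n C k) * B k * (x ^ (suc n ∸ k)))
    cancel : ∀ s b → s + 1ℚ * b * 1ℚ - b ≡ s
    cancel = solve-∀ ringℚ

  -- The indices are p - 2 and 2p - 3. These numbers control the constant term of B_(p-2)(x) and the
  -- linear terms of B_(p-1)(x) and B_(2p-2)(x), the places where x supplies too few factors p.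
  module OddVanishing (B[q₁]≡0 : B q₁ ≡ 0ℚ) (B[q+q₁]≡0 : B (q ℕ.+ q₁) ≡ 0ℚ) (4≤q : 4 ≤ q) where

    V-Bpoly[q₁] : ∀ {x} → V 1 x → V 1 (Bpoly q₁ x)
    V-Bpoly[q₁] {x} Vx = subst (V 1) (cancel (Bpoly q₁ x) (B q₁))
      (V-+ (subst (V 1) (sym (Bpoly-constant q₂ x)) (sum0-V q₂ V-term)) (subst (V 1) (sym B[q₁]≡0) (V-0 1)))
      where
      cancel : ∀ a b → a - b + b ≡ a
      cancel = solve-∀ ringℚ
      V-term : ∀ k → k ≤ q₂ → V 1 (ι (q₁ C k) * B k * (x ^ (q₁ ∸ k)))
      V-term k k≤q₂ = V-*ˡ (Int-* (Int-ι (q₁ C k)) (Int-B-small (suc k) k ℕ.≤-refl (ℕ.m≤n⇒m≤1+n k≤q₂)))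
        (V-≥ (ℕ.m<n⇒0<n∸m (s≤s k≤q₂)) (V-^ (q₁ ∸ k) Vx))

    -- Terms with x² or higher and an integral coefficient are divisible by p², and the linear term
    -- carries B n = 0. The term of B_(p-1) is left to a hypothesis because its coefficient need not
    -- be integral.
    V-Bpoly-constant : ∀ n → n < q ℕ.+ q → B n ≡ 0ℚ →
      (∀ {x} → V 1 x → q ≤ n → V 2 (ι (suc n C q) * B q * (x ^ (suc n ∸ q)))) →
      ∀ {x} → V 1 x → V 2 (Bpoly (suc n) x - B (suc n))
    V-Bpoly-constant n n<2q Bn≡0 at-q {x} Vx = subst (V 2) (sym (Bpoly-constant n x)) (sum0-V n V-term)
      where
      zeroes : ∀ a b → a * 0ℚ * b ≡ 0ℚ
      zeroes = solve-∀ ringℚ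
      term : ℕ → ℚ
      term k = ι (suc n C k) * B k * (x ^ (suc n ∸ k))
      generic : ∀ k → k < n → k ≢ q → V 2 (term k)
      generic k k<n k≢q = V-*ˡ (Int-* (Int-ι (suc n C k)) (Int-B k (ℕ.<-trans k<n n<2q) k≢q))
        (V-≥ (subst (2 ≤_) (sym (ℕ.+-∸-assoc 1 (ℕ.<⇒≤ k<n))) (s≤s (ℕ.m<n⇒0<n∸m k<n))) (V-^ (suc n ∸ k) Vx))
      last : V 2 (term n)
      last = subst (V 2) (sym (trans (cong (λ s → ι (suc n C n) * s * (x ^ (suc n ∸ n))) Bn≡0) (zeroes (ι (suc n C n)) (x ^ (suc n ∸ n))))) (V-0 2)
      V-term : ∀ k → k ≤ n → V 2 (term k)
      V-term k k≤n = [ (λ k<n → [ (λ k≡q → subst (λ i → V 2 (term i)) (sym k≡q) (at-q Vx (subst (_≤ n) k≡q k≤n)))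
                              , generic k k<n ]′ (decide (k ℕ.≟ q)))
                     , (λ k≡n → subst (λ i → V 2 (term i)) (sym k≡n) last) ]′ (ℕ.m≤n⇒m<n∨m≡n k≤n)
        where
        decide : Dec (k ≡ q) → k ≡ q ⊎ k ≢ q
        decide (yes e) = inj₁ e
        decide (no ¬e) = inj₂ ¬e

    V-Bpoly[q] : ∀ {x} → V 1 x → V 2 (Bpoly q x - B q)
    V-Bpoly[q] = V-Bpoly-constant q₁ (ℕ.m≤m+n q q) B[q₁]≡0
      (λ _ q≤q₁ → contradiction q≤q₁ (ℕ.n≮n q₁))

    V-Bpoly[q+q] : ∀ {x} → V 1 x → V 2 (Bpoly (q ℕ.+ q) x - B (q ℕ.+ q))
    V-Bpoly[q+q] {x} Vx = subst (λ n → V 2 (Bpoly n x - B n)) (sym (ℕ.+-suc q q₁))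
      (V-Bpoly-constant (q ℕ.+ q₁) (subst (q ℕ.+ q₁ <_) (sym (ℕ.+-suc q q₁)) ℕ.≤-refl) B[q+q₁]≡0 at-q Vx)
      where
      -- One factor of x^(p-1) turns B_(p-1) into the integral p B_(p-1) t; the remaining p - 2 ≥ 2
      -- factors give p².
      at-q : ∀ {x} → V 1 x → q ≤ q ℕ.+ q₁ → V 2 (ι (suc (q ℕ.+ q₁) C q) * B q * (x ^ (suc (q ℕ.+ q₁) ∸ q)))
      at-q {x} (mkV t It x≡) _ = subst (λ e → V 2 (ι (suc (q ℕ.+ q₁) C q) * B q * (x ^ e)))
        (sym (trans (cong (_∸ q) (sym (ℕ.+-suc q q₁))) (ℕ.m+n∸m≡n q q)))
        (subst (V 2) (sym factored) (V-*ˡ (Int-* (Int-ι (suc (q ℕ.+ q₁) C q)) (Int-* Int-π*B-q It))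
          (V-≥ (ℕ.≤-trans (s≤s (s≤s z≤n)) (ℕ.s≤s⁻¹ 4≤q)) (V-^ q₁ (mkV t It x≡)))))
        where
        c y : ℚ
        c = ι (suc (q ℕ.+ q₁) C q)
        y = x ^ q₁
        rearrange : ∀ c b π t y → c * b * (π * t * y) ≡ c * (π * b * t) * y
        rearrange = solve-∀ ringℚ
        factored : c * B q * (x * y) ≡ c * (π * B q * t) * y
        factored = trans (cong (λ s → c * B q * (s * y)) (trans x≡ (cong (_* t) p^1≡π))) (rearrange c (B q) π t y)

-- Evaluation of the sums and of the Bernoulli polynomials modulo p²

module Supercongruence
  (q₂ m h : ℕ) (q₂≡ : q₂ ≡ suc m ℕ.+ suc m) (q≡h+h : suc (suc q₂) ≡ h ℕ.+ h)
  (p-prime : Prime (suc (suc (suc q₂)))) where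

  -- The parameters q₂ = 2m + 2 and p - 1 = 2h record that p is odd and at least 5.
  q₁ q p : ℕ
  q₁ = suc q₂
  q  = suc q₁
  p  = suc q

  open Binomials q p-prime public
  open PrimeBinomials q p-prime public
  open BernoulliIntegrality q₂ p-prime public

  B[q₁]≡0 : B q₁ ≡ 0ℚ
  B[q₁]≡0 = subst (λ n → B (suc n) ≡ 0ℚ) (sym q₂≡) (B-odd m)

  1≤q₂ : 1 ≤ q₂
  1≤q₂ = subst (1 ≤_) (sym q₂≡) (s≤s z≤n)

  4≤q : 4 ≤ q
  4≤q = s≤s (s≤s (subst (2 ≤_) (sym q₂≡) (s≤s (subst (1 ≤_) (sym (ℕ.+-suc m m)) (s≤s z≤n)))))

  -- `q ℕ.+ q₁` unfolds to suc (q₁ + q₁), which is the index in `B-odd q₂`.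
  open OddVanishing B[q₁]≡0 (B-odd q₂) 4≤q public
  open Shifted h q≡h+h public

  Int-½ : Int (recip 2)
  Int-½ = Int-recip-≤ {1} (ℕ.≤-trans (s≤s (s≤s z≤n)) 4≤q)

  module Sums (t : ℚ) (It : Int t) where

    open Residue t It public

    cc : ℕ → ℚ
    cc j = c j * c j

    Icc : ∀ j → suc j ≤ q → Int (cc (suc j))
    Icc j j<q = Int-* (Ic j j<q) (Ic j j<q)

    b-0 : b 0 ≡ x
    b-0 = ℚ.+-identityʳ x

    -- Fermat's little theorem at a rational argument: both sides vanish modulo p at b 0 = x, and
    -- `frobenius` moves up by one.
    fermat : ∀ j → b j ^ p ≈ b j [ 1 ]
    fermat zero    = ≈-trans (V⇒≈0 (subst (λ y → V 1 (y ^ p)) (sym b-0) (V-≥ (s≤s z≤n) (V-^ p Vx))))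
      (≈-sym (V⇒≈0 (subst (V 1) (sym b-0) Vx)))
    fermat (suc j) = begin
      b (suc j) ^ p        ≡⟨ cong (_^ p) (b-suc j) ⟩
      (b j + 1ℚ) ^ p       ≈⟨ frobenius (Ib j) ⟩
      (b j ^ p) + 1ℚ       ≈⟨ ≈-+ (fermat j) ≈-refl ⟩
      b j + 1ℚ             ≡⟨ b-suc j ⟨
      b (suc j)            ∎
      where open SetoidReasoning (≈-setoid 1)

    fermat-unit : ∀ j → suc j ≤ q → (- b (suc j)) ^ q ≈ 1ℚ [ 1 ]
    fermat-unit j j<q = begin
      (- β) ^ q            ≡⟨ trans (cong ((- β) ^_) q≡h+h) (trans (neg-^-even β h) (cong (β ^_) (sym q≡h+h))) ⟩
      β ^ q                ≡⟨ ℚ.*-identityˡ (β ^ q) ⟨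
      1ℚ * (β ^ q)         ≡⟨ cong (_* (β ^ q)) (b*c j j<q) ⟨
      β * d * (β ^ q)      ≡⟨ rearrange β d (β ^ q) ⟩
      d * (β * (β ^ q))    ≈⟨ ≈-*ˡ (Ic j j<q) (fermat (suc j)) ⟩
      d * β                ≡⟨ trans (ℚ.*-comm d β) (b*c j j<q) ⟩
      1ℚ                   ∎
      where
      open SetoidReasoning (≈-setoid 1)
      β d : ℚ
      β = b (suc j)
      d = c (suc j)
      rearrange : ∀ β d y → β * d * y ≡ d * (β * y)
      rearrange = solve-∀ ringℚ

    -- p - 3 is (p - 1) - 2, so Fermat leaves the inverse square.
    b^q₂≈cc : ∀ j → suc j ≤ q → (- b (suc j)) ^ q₂ ≈ cc (suc j) [ 1 ]
    b^q₂≈cc j j<q = begin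
      v                              ≡⟨ units v ⟩
      (1ℚ * 1ℚ) * v                  ≡⟨ cong (λ s → (s * s) * v) (b*c j j<q) ⟨
      ((β * d) * (β * d)) * v        ≡⟨ rearrange β d v ⟩
      (d * d) * (- β * (- β * v))    ≈⟨ ≈-*ˡ (Icc j j<q) (fermat-unit j j<q) ⟩
      (d * d) * 1ℚ                   ≡⟨ ℚ.*-identityʳ (d * d) ⟩
      d * d                          ∎
      where
      open SetoidReasoning (≈-setoid 1)
      β d v : ℚ
      β = b (suc j)
      d = c (suc j)
      v = (- b (suc j)) ^ q₂
      units : ∀ v → v ≡ (1ℚ * 1ℚ) * v
      units = solve-∀ ringℚ
      rearrange : ∀ β d v → ((β * d) * (β * d)) * v ≡ (d * d) * (- β * (- β * v))
      rearrange = solve-∀ ringℚ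

    -- Passing from - b r to - b (r + 1) goes down by one, so the power at the lower point - b (r +
    -- 1) is subtracted.
    Bpoly-shift : ∀ n r → Bpoly (suc n) (- b r) ≡ Bpoly (suc n) (- x) - ι (suc n) * sum1 r (λ j → (- b j) ^ n)
    Bpoly-shift n zero    = trans (cong (λ s → Bpoly (suc n) (- s)) b-0) (pad (Bpoly (suc n) (- x)) (ι (suc n)))
      where
      pad : ∀ a m → a ≡ a - m * 0ℚ
      pad = solve-∀ ringℚ
    Bpoly-shift n (suc r) = begin
      β                                        ≡⟨ add β (N * y) ⟩
      (β + N * y) - N * y                      ≡⟨ cong (_- N * y) (Bpoly-difference n (- b (suc r))) ⟨
      Bpoly (suc n) (1ℚ + - b (suc r)) - N * y ≡⟨ cong (λ s → Bpoly (suc n) s - N * y) shift ⟩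
      Bpoly (suc n) (- b r) - N * y            ≡⟨ cong (_- N * y) (Bpoly-shift n r) ⟩
      β₀ - N * Σ - N * y                       ≡⟨ collect β₀ N Σ y ⟩
      β₀ - N * (Σ + y)                         ∎
      where
      open ≡-Reasoning
      β β₀ N y Σ : ℚ
      β  = Bpoly (suc n) (- b (suc r))
      β₀ = Bpoly (suc n) (- x)
      N  = ι (suc n)
      y  = (- b (suc r)) ^ n
      Σ  = sum1 r (λ j → (- b j) ^ n)
      add : ∀ β s → β ≡ (β + s) - s
      add = solve-∀ ringℚ
      collect : ∀ a N s y → a - N * s - N * y ≡ a - N * (s + y)
      collect = solve-∀ ringℚ
      peel : ∀ b → 1ℚ + - (b + 1ℚ) ≡ - b
      peel = solve-∀ ringℚ
      shift : 1ℚ + - b (suc r) ≡ - b r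
      shift = trans (cong (λ s → 1ℚ + - s) (b-suc r)) (peel (b r))

    V[-x] : V 1 (- x)
    V[-x] = V-neg Vx

    -- Comparing the values of Bpoly q₁ at - x and at - (x + p), which are both divisible by p.
    V-Σcc[q] : V 1 (sum1 q cc)
    V-Σcc[q] = ≈0⇒V (≈-trans (≈-sym (sum1-≈ q b^q₂≈cc)) (V⇒≈0 V-Σ))
      where
      Σ y : ℚ
      Σ = sum1 q (λ j → (- b j) ^ q₂)
      y = (- b p) ^ q₂
      Vb[p] : V 1 (- b p)
      Vb[p] = V-neg (V-+ Vx V-π)
      isolate : ∀ r N a s y → s ≡ (1ℚ - N * r) * s + r * (a - (a - N * (s + y))) - r * N * y
      isolate = solve-∀ ringℚ
      V-Σ : V 1 Σ
      V-Σ = subst (V 1) (sym eq) (V-+ (V-*ˡ (Int-recip-≤ q₁≤q) (V-+ (V-Bpoly[q₁] V[-x]) (V-neg (V-Bpoly[q₁] Vb[p]))))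
          (V-neg (V-*ˡ (Int-* (Int-recip-≤ q₁≤q) (Int-ι q₁)) (V-≥ 1≤q₂ (V-^ q₂ Vb[p])))))
        where
        q₁≤q : q₁ ≤ q
        q₁≤q = ℕ.n≤1+n q₁
        drop : ∀ s u → (1ℚ - 1ℚ) * s + u ≡ u
        drop = solve-∀ ringℚ
        assoc : ∀ a b c → a + b - c ≡ a + (b - c)
        assoc = solve-∀ ringℚ
        open ≡-Reasoning
        R : ℚ
        R = recip q₁ * (Bpoly q₁ (- x) - Bpoly q₁ (- b p)) - recip q₁ * ι q₁ * y
        eq : Σ ≡ R
        eq = begin
          Σ ≡⟨ isolate (recip q₁) (ι q₁) (Bpoly q₁ (- x)) Σ y ⟩
          (1ℚ - ι q₁ * recip q₁) * Σ + recip q₁ * (Bpoly q₁ (- x) - (Bpoly q₁ (- x) - ι q₁ * (Σ + y))) - recip q₁ * ι q₁ * y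
            ≡⟨ cong₂ (λ s u → (1ℚ - s) * Σ + recip q₁ * (Bpoly q₁ (- x) - u) - recip q₁ * ι q₁ * y) (recip-inverseʳ q₂) (sym (Bpoly-shift q₂ p)) ⟩
          (1ℚ - 1ℚ) * Σ + recip q₁ * (Bpoly q₁ (- x) - Bpoly q₁ (- b p)) - recip q₁ * ι q₁ * y
            ≡⟨ assoc ((1ℚ - 1ℚ) * Σ) (recip q₁ * (Bpoly q₁ (- x) - Bpoly q₁ (- b p))) (recip q₁ * ι q₁ * y) ⟩
          (1ℚ - 1ℚ) * Σ + R ≡⟨ drop Σ R ⟩
          R ∎

    -- b_j + b_(p-j) = 2x + p is divisible by p, so the two inverses are opposite modulo p and their
    -- squares agree.
    cc-reflect : ∀ i → suc i ≤ h → cc (p ∸ suc i) ≈ cc (suc i) [ 1 ]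
    cc-reflect i i<h = mk≈ (subst (V 1) (squares d d′) (V-*ʳ V-d+d′ (Int-- Id′ Id)))
      where
      open ≡-Reasoning
      i<q : suc i ≤ q
      i<q = ℕ.≤-trans i<h h≤q
      i′ : ℕ
      i′ = q₁ ∸ i
      q∸i≡ : q ∸ i ≡ suc i′
      q∸i≡ = ℕ.+-∸-assoc 1 (ℕ.s≤s⁻¹ i<q)
      d d′ : ℚ
      d  = c (suc i)
      d′ = c (q ∸ i)
      i′<q : suc i′ ≤ q
      i′<q = subst (_≤ q) q∸i≡ (ℕ.m∸n≤m q i)
      Id : Int d
      Id = Ic i i<q
      Id′ : Int d′
      Id′ = subst (λ k → Int (c k)) (sym q∸i≡) (Ic i′ i′<q)
      b*c′ : b (q ∸ i) * d′ ≡ 1ℚ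
      b*c′ = subst (λ k → b k * c k ≡ 1ℚ) (sym q∸i≡) (b*c i′ i′<q)
      squares : ∀ d d′ → (d + d′) * (d′ - d) ≡ d′ * d′ - d * d
      squares = solve-∀ ringℚ
      swap : ∀ d d′ β β′ → d * (β′ * d′) + d′ * (β * d) ≡ d * d′ * (β + β′)
      swap = solve-∀ ringℚ
      units : ∀ d d′ → d + d′ ≡ d * 1ℚ + d′ * 1ℚ
      units = solve-∀ ringℚ
      group : ∀ x u v → (x + u) + (x + v) ≡ x + x + (u + v)
      group = solve-∀ ringℚ
      d+d′ : d + d′ ≡ d * d′ * (x + x + π)
      d+d′ = begin
        d + d′                                      ≡⟨ units d d′ ⟩
        d * 1ℚ + d′ * 1ℚ                            ≡⟨ cong₂ (λ s u → d * s + d′ * u) b*c′ (b*c i i<q) ⟨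
        d * (b (q ∸ i) * d′) + d′ * (b (suc i) * d) ≡⟨ swap d d′ (b (suc i)) (b (q ∸ i)) ⟩
        d * d′ * (b (suc i) + b (q ∸ i))            ≡⟨ cong (d * d′ *_) (trans (group x (ι (suc i)) (ι (q ∸ i)))
              (cong (λ s → x + x + s) (trans (sym (ι-+ (suc i) (q ∸ i))) (cong (λ k → ι (suc k)) (ℕ.m+[n∸m]≡n (ℕ.<⇒≤ i<q)))))) ⟩
        d * d′ * (x + x + π)                        ∎
      V-d+d′ : V 1 (d + d′)
      V-d+d′ = subst (V 1) (sym d+d′) (V-*ˡ (Int-* Id Id′) (V-+ (V-+ Vx Vx) V-π))

    -- By reflection the full sum is twice the half sum modulo p, and 2 is a unit.
    V-Σcc[h] : V 1 (sum1 h cc)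
    V-Σcc[h] = subst (V 1) (half (sum1 h cc)) (V-*ˡ Int-½ (≈0⇒V (≈-trans (≈-sym split) (V⇒≈0 V-Σcc[q]))))
      where
      half : ∀ s → recip 2 * (s + s) ≡ s
      half s = trans (double (recip 2) s) (ℚ.*-identityˡ s)
        where
        double : ∀ r s → r * (s + s) ≡ (r + r) * s
        double = solve-∀ ringℚ
      split : sum1 q cc ≈ sum1 h cc + sum1 h cc [ 1 ]
      split = ≈-trans (≈-reflexive (subst (λ n → sum1 n cc ≡ sum1 h cc + sum1 h (λ i → cc (suc n ∸ i))) (sym q≡h+h) (sum1-reverse h h cc)))
        (≈-+ (≈-refl {x = sum1 h cc}) (sum1-≈ h cc-reflect))

    -- 1/k - 1/(x + k) = x / (k (x + k)), and p divides x.
    recip≈c : ∀ k → suc k ≤ q → recip (suc k) ≈ c (suc k) [ 1 ]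
    recip≈c k k<q = mk≈ (subst (V 1) eq (V-*ˡ (Int-* (Int-recip-≤ k<q) (Ic k k<q)) Vx))
      where
      r d n : ℚ
      r = recip (suc k)
      d = c (suc k)
      n = ι (suc k)
      split : ∀ r d x n → r * d * x ≡ r * ((x + n) * d) - n * r * d
      split = solve-∀ ringℚ
      units : ∀ r d → r * 1ℚ - 1ℚ * d ≡ r - d
      units = solve-∀ ringℚ
      eq : r * d * x ≡ r - d
      eq = trans (split r d x n) (trans (cong₂ (λ s u → r * s - u * d) (b*c k k<q) (recip-inverseʳ k)) (units r d))

    recip²≈cc : ∀ k → suc k ≤ q → recip (suc k) * recip (suc k) ≈ cc (suc k) [ 1 ]
    recip²≈cc k k<q = ≈-trans (≈-*ˡ (Int-recip-≤ k<q) (recip≈c k k<q)) (≈-*ʳ (Ic k k<q) (recip≈c k k<q))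

    V-Σrecip² : ∀ n → n ≤ q → V 1 (sum1 n cc) → V 1 (sum1 n (λ k → recip k * recip k))
    V-Σrecip² n n≤q Vcc = ≈0⇒V (≈-trans (sum1-≈ n (λ k k<n → recip²≈cc k (ℕ.≤-trans k<n n≤q))) (V⇒≈0 Vcc))

    -- C(x, k+1) = x/(k + 1) C(x-1, k); the factor x lifts C(x-1, k) ≡ (-1)^k to modulus p².
    binom[x]≈ : ∀ k → suc k ≤ q → binom x (suc k) ≈ x * (recip (suc k) * sign k) [ 2 ]
    binom[x]≈ k k<q = begin
      binom x (suc k)                         ≡⟨ cong (λ s → binom s (suc k)) (restore x) ⟨
      binom (x - 1ℚ + 1ℚ) (suc k)             ≡⟨ recip-solve k (binom-sucˡ (x - 1ℚ) k) ⟩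
      r * ((x - 1ℚ + 1ℚ) * binom (x - 1ℚ) k)  ≡⟨ rearrange r x (binom (x - 1ℚ) k) ⟩
      x * (r * binom (x - 1ℚ) k)              ≈⟨ ≈-scale Vx (≈-*ˡ (Int-recip-≤ k<q) (binom≈sign k (ℕ.<⇒≤ k<q) (subst (V 1) (sym (restore x)) Vx))) ⟩
      x * (r * sign k)                        ∎
      where
      open SetoidReasoning (≈-setoid 2)
      r : ℚ
      r = recip (suc k)
      restore : ∀ x → x - 1ℚ + 1ℚ ≡ x
      restore = solve-∀ ringℚ
      rearrange : ∀ r x u → r * ((x - 1ℚ + 1ℚ) * u) ≡ x * (r * u)
      rearrange = solve-∀ ringℚ

    Int-sign : ∀ k → Int (sign k)
    Int-sign k = Int-^ k (Int-fromℤ -[1+ 0 ])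

    -- The common form of both sums at x, with e = 1 for S and e = - 1 for F: x supplies one factor
    -- p and Σ 1/k² ≡ Σ c_k² the other.
    xΣrecip²≈0 : ∀ n e → n ≤ q → Int e → V 1 (sum1 n cc) → sum1 n (λ k → e * x * (recip k * recip k)) ≈ 0ℚ [ 2 ]
    xΣrecip²≈0 n e n≤q Ie Vcc = V⇒≈0 (subst (V 2) (sym (sum1-*ˡ n (e * x) (λ k → recip k * recip k)))
      (V-*-V (V-*ˡ Ie Vx) (V-Σrecip² n n≤q Vcc)))

    alternatingSum[x]≈0 : alternatingSum q x ≈ 0ℚ [ 2 ]
    alternatingSum[x]≈0 = ≈-trans (sum1-≈ q term) (xΣrecip²≈0 q 1ℚ ℕ.≤-refl (Int-ι 1) V-Σcc[q])
      where
      term : ∀ k → suc k ≤ q → sign k * recip (suc k) * binom x (suc k) ≈ 1ℚ * x * (recip (suc k) * recip (suc k)) [ 2 ]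
      term k k<q = ≈-trans (≈-*ˡ (Int-* (Int-sign k) (Int-recip-≤ k<q)) (binom[x]≈ k k<q))
        (≈-reflexive (trans (rearrange (sign k) (recip (suc k)) x) (cong (λ s → s * x * (recip (suc k) * recip (suc k))) (sign*sign k))))
        where
        rearrange : ∀ e r x → e * r * (x * (r * e)) ≡ e * e * x * (r * r)
        rearrange = solve-∀ ringℚ

    productSum[x]≈0 : productSum h x ≈ 0ℚ [ 2 ]
    productSum[x]≈0 = ≈-trans (sum1-≈ h term) (xΣrecip²≈0 h (- 1ℚ) h≤q (Int-fromℤ -[1+ 0 ]) V-Σcc[h])
      where
      restore : ∀ x → - 1ℚ - x + 1ℚ ≡ - x
      restore = solve-∀ ringℚ
      term : ∀ k → suc k ≤ h → binom x (suc k) * binom (- 1ℚ - x) (suc k) * recip (suc k) ≈ - 1ℚ * x * (recip (suc k) * recip (suc k)) [ 2 ]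
      term k k<h = begin
        binom x (suc k) * z * r           ≈⟨ ≈-*ʳ Ir (≈-*ʳ Iz (binom[x]≈ k k<q)) ⟩
        x * (r * e) * z * r               ≡⟨ group x r e z ⟩
        x * (r * e * r * z)               ≈⟨ ≈-scale Vx (≈-*ˡ (Int-* (Int-* Ir (Int-sign k)) Ir) (binom≈sign (suc k) k<q (subst (V 1) (sym (restore x)) V[-x]))) ⟩
        x * (r * e * r * (- 1ℚ * e))      ≡⟨ rearrange x r e ⟩
        - 1ℚ * x * (r * r) * (e * e)      ≡⟨ trans (cong (- 1ℚ * x * (r * r) *_) (sign*sign k)) (ℚ.*-identityʳ (- 1ℚ * x * (r * r))) ⟩
        - 1ℚ * x * (r * r)                ∎
        where
        open SetoidReasoning (≈-setoid 2)
        k<q : suc k ≤ q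
        k<q = ℕ.≤-trans k<h h≤q
        r e z : ℚ
        r = recip (suc k)
        e = sign k
        z = binom (- 1ℚ - x) (suc k)
        Ir : Int r
        Ir = Int-recip-≤ k<q
        Iz : Int z
        Iz = Int-binom (suc k) k<q (Int-- (Int-fromℤ -[1+ 0 ]) (V⇒Int Vx))
        group : ∀ x r e z → x * (r * e) * z * r ≡ x * (r * e * r * z)
        group = solve-∀ ringℚ
        rearrange : ∀ x r e → x * (r * e * r * (- 1ℚ * e)) ≡ - 1ℚ * x * (r * r) * (e * e)
        rearrange = solve-∀ ringℚ

    alternatingSum≈ : ∀ r → r ≤ q → alternatingSum q (b r) ≈ sum1 r c - x * sum1 r cc [ 2 ]
    alternatingSum≈ zero    r≤q = ≈-trans (≈-reflexive (cong (alternatingSum q) b-0)) (≈-trans alternatingSum[x]≈0 (≈-reflexive (zero-sum x)))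
      where
      zero-sum : ∀ x → 0ℚ ≡ 0ℚ - x * 0ℚ
      zero-sum = solve-∀ ringℚ
    alternatingSum≈ (suc r) r<q = begin
      S                                                   ≡⟨ split S S₀ ⟩
      S₀ + (S - S₀)                                       ≈⟨ ≈-+ (alternatingSum≈ r (ℕ.<⇒≤ r<q)) (alternatingSum-step r r<q) ⟩
      sum1 r c - x * sum1 r cc + (c (suc r) - x * cc (suc r)) ≡⟨ merge (sum1 r c) (sum1 r cc) x (c (suc r)) (cc (suc r)) ⟩
      sum1 r c + c (suc r) - x * (sum1 r cc + cc (suc r)) ∎
      where
      open SetoidReasoning (≈-setoid 2)
      S S₀ : ℚ
      S  = alternatingSum q (b (suc r))
      S₀ = alternatingSum q (b r)
      split : ∀ s s₀ → s ≡ s₀ + (s - s₀)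
      split = solve-∀ ringℚ
      merge : ∀ a a′ x d d′ → a - x * a′ + (d - x * d′) ≡ a + d - x * (a′ + d′)
      merge = solve-∀ ringℚ

    -- For j ≤ h the index j + h stays below p, so there is no carry: ε = 0 at every step.
    combinedSum-low : ∀ r → r ≤ h → combinedSum (b r) ≈ 0ℚ [ 2 ]
    combinedSum-low zero    r≤h = ≈-trans (≈-reflexive (cong combinedSum b-0))
      (≈-+ productSum[x]≈0 (≈-*ˡ (Int-ι 2) alternatingSum[x]≈0))
    combinedSum-low (suc r) r<h = begin
      T                                               ≡⟨ split T T₀ ⟩
      T₀ + (T - T₀)                                   ≈⟨ ≈-+ (combinedSum-low r (ℕ.<⇒≤ r<h)) (combinedSum-step r (Int-ι 0) (ℕ.≤-trans r<h h≤q) carry) ⟩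
      0ℚ + (1ℚ + 1ℚ) * (π * (0ℚ * cc (suc r)))        ≡⟨ zeroes π (cc (suc r)) ⟩
      0ℚ                                              ∎
      where
      open SetoidReasoning (≈-setoid 2)
      T T₀ : ℚ
      T  = combinedSum (b (suc r))
      T₀ = combinedSum (b r)
      split : ∀ s s₀ → s ≡ s₀ + (s - s₀)
      split = solve-∀ ringℚ
      zeroes : ∀ π d → 0ℚ + (1ℚ + 1ℚ) * (π * (0ℚ * d)) ≡ 0ℚ
      zeroes = solve-∀ ringℚ
      carry : binom (x + ι (suc r ℕ.+ h)) p ≈ t + 0ℚ [ 1 ]
      carry = ≈-trans (binom-p (suc r ℕ.+ h) (subst (suc r ℕ.+ h ≤_) (sym q≡h+h) (ℕ.+-monoˡ-≤ h r<h)) It)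
        (≈-reflexive (sym (ℚ.+-identityʳ t)))

    -- At j = h + k + 1 the index j + h equals p + k, so from here on every step has ε = 1.
    combinedSum-high : ∀ k → h ℕ.+ k ≤ q →
      combinedSum (b (h ℕ.+ k)) ≈ (1ℚ + 1ℚ) * (π * (sum1 (h ℕ.+ k) cc - sum1 h cc)) [ 2 ]
    combinedSum-high zero    _ = ≈-trans (combinedSum-low (h ℕ.+ 0) (ℕ.≤-reflexive (ℕ.+-identityʳ h)))
      (≈-reflexive (trans (zeroes π (sum1 h cc)) (cong (λ n → (1ℚ + 1ℚ) * (π * (sum1 n cc - sum1 h cc))) (sym (ℕ.+-identityʳ h)))))
      where
      zeroes : ∀ π s → 0ℚ ≡ (1ℚ + 1ℚ) * (π * (s - s))
      zeroes = solve-∀ ringℚ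
    combinedSum-high (suc k) h+1+k≤q = subst (λ n → combinedSum (b n) ≈ (1ℚ + 1ℚ) * (π * (sum1 n cc - sum1 h cc)) [ 2 ]) (sym (ℕ.+-suc h k)) (begin
      T                                               ≡⟨ split T T₀ ⟩
      T₀ + (T - T₀)                                   ≈⟨ ≈-+ (combinedSum-high k (ℕ.<⇒≤ r<q)) (combinedSum-step r (Int-ι 1) r<q carry) ⟩
      (1ℚ + 1ℚ) * (π * (sum1 r cc - sum1 h cc)) + (1ℚ + 1ℚ) * (π * (1ℚ * cc (suc r)))
        ≡⟨ merge π (sum1 r cc) (sum1 h cc) (cc (suc r)) ⟩
      (1ℚ + 1ℚ) * (π * (sum1 r cc + cc (suc r) - sum1 h cc)) ∎)
      where
      open SetoidReasoning (≈-setoid 2)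
      r : ℕ
      r = h ℕ.+ k
      r<q : suc r ≤ q
      r<q = subst (_≤ q) (ℕ.+-suc h k) h+1+k≤q
      T T₀ : ℚ
      T  = combinedSum (b (suc r))
      T₀ = combinedSum (b r)
      split : ∀ s s₀ → s ≡ s₀ + (s - s₀)
      split = solve-∀ ringℚ
      merge : ∀ π s s′ d → (1ℚ + 1ℚ) * (π * (s - s′)) + (1ℚ + 1ℚ) * (π * (1ℚ * d)) ≡ (1ℚ + 1ℚ) * (π * (s + d - s′))
      merge = solve-∀ ringℚ
      index : suc r ℕ.+ h ≡ p ℕ.+ k
      index = cong suc (trans (ℕ.+-assoc h k h) (trans (cong (h ℕ.+_) (ℕ.+-comm k h))
        (trans (sym (ℕ.+-assoc h h k)) (cong (ℕ._+ k) (sym q≡h+h)))))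
      carry : binom (x + ι (suc r ℕ.+ h)) p ≈ t + 1ℚ [ 1 ]
      carry = subst (λ n → binom (x + ι n) p ≈ t + 1ℚ [ 1 ]) (sym index)
        (binom-p-carry k (ℕ.≤-trans (ℕ.m≤n+m k h) (ℕ.<⇒≤ r<q)) It)

    -- The factor 2 is - (p - 2) modulo p, the coefficient in the difference equation of degree p -
    -- 2.
    Bpoly[q₁]≈ : ∀ r → r ≤ q → Bpoly q₁ (- b r) ≈ (1ℚ + 1ℚ) * sum1 r cc [ 1 ]
    Bpoly[q₁]≈ r r≤q = begin
      Bpoly q₁ (- b r)                     ≡⟨ Bpoly-shift q₂ r ⟩
      Bpoly q₁ (- x) - ι q₁ * Σ            ≈⟨ ≈-- (V⇒≈0 (V-Bpoly[q₁] V[-x])) (≈-*ˡ (Int-ι q₁) (sum1-≈ r (λ j j<r → b^q₂≈cc j (ℕ.≤-trans j<r r≤q)))) ⟩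
      0ℚ - ι q₁ * sum1 r cc                ≡⟨ expand (ι q₁) (sum1 r cc) ⟩
      (1ℚ + 1ℚ) * sum1 r cc - (ι q₁ + 1ℚ + 1ℚ) * sum1 r cc ≡⟨ cong (λ s → (1ℚ + 1ℚ) * sum1 r cc - s * sum1 r cc) (trans (cong (_+ 1ℚ) (sym (ι-suc q₁))) (sym (ι-suc q))) ⟩
      (1ℚ + 1ℚ) * sum1 r cc - π * sum1 r cc ≈⟨ ≈-- (≈-refl {x = (1ℚ + 1ℚ) * sum1 r cc}) (V⇒≈0 (V-*ʳ V-π (Int-Σcc r r≤q))) ⟩
      (1ℚ + 1ℚ) * sum1 r cc - 0ℚ           ≡⟨ ℚ.+-identityʳ ((1ℚ + 1ℚ) * sum1 r cc) ⟩
      (1ℚ + 1ℚ) * sum1 r cc                ∎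
      where
      open SetoidReasoning (≈-setoid 1)
      Σ : ℚ
      Σ = sum1 r (λ j → (- b j) ^ q₂)
      Int-Σcc : ∀ r → r ≤ q → Int (sum1 r cc)
      Int-Σcc zero    _   = Int-ι 0
      Int-Σcc (suc r) r<q = Int-+ (Int-Σcc r (ℕ.<⇒≤ r<q)) (Icc r r<q)
      expand : ∀ n s → 0ℚ - n * s ≡ (1ℚ + 1ℚ) * s - (n + 1ℚ + 1ℚ) * s
      expand = solve-∀ ringℚ

    -- The hypothesis removes the value at - x, and dividing by the degree cancels the coefficient
    -- in front of the power sum.
    Bpoly-quotient≈ : ∀ n r → ¬ p ∣ suc n → V 2 (Bpoly (suc n) (- x) - B (suc n)) →
      (Bpoly (suc n) (- b r) - B (suc n)) * recip (suc n) ≈ - sum1 r (λ j → (- b j) ^ n) [ 2 ]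
    Bpoly-quotient≈ n r p∤ Vconst = begin
      (Bpoly (suc n) (- b r) - B (suc n)) * ρ  ≡⟨ cong (λ s → (s - B (suc n)) * ρ) (Bpoly-shift n r) ⟩
      (β₀ - N * Σ - B (suc n)) * ρ             ≡⟨ rearrange β₀ N Σ (B (suc n)) ρ ⟩
      (β₀ - B (suc n)) * ρ - N * ρ * Σ         ≡⟨ cong (λ s → (β₀ - B (suc n)) * ρ - s * Σ) (recip-inverseʳ n) ⟩
      (β₀ - B (suc n)) * ρ - 1ℚ * Σ            ≈⟨ ≈-- (V⇒≈0 (V-*ʳ Vconst (Int-recip p∤))) (≈-refl {x = 1ℚ * Σ}) ⟩
      0ℚ - 1ℚ * Σ                              ≡⟨ neg Σ ⟩
      - Σ                                      ∎
      where
      open SetoidReasoning (≈-setoid 2)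
      β₀ N Σ ρ : ℚ
      β₀ = Bpoly (suc n) (- x)
      N  = ι (suc n)
      Σ  = sum1 r (λ j → (- b j) ^ n)
      ρ  = recip (suc n)
      rearrange : ∀ a N s b r → (a - N * s - b) * r ≡ (a - b) * r - N * r * s
      rearrange = solve-∀ ringℚ
      neg : ∀ s → 0ℚ - 1ℚ * s ≡ - s
      neg = solve-∀ ringℚ

    -- With F = (- b)^(p-1) the difference of the two sides is - c (F - 1)².
    powers≈c : ∀ j → suc j ≤ q →
      ((- b (suc j)) ^ (q₁ ℕ.+ q)) - (1ℚ + 1ℚ) * ((- b (suc j)) ^ q₁) ≈ c (suc j) [ 2 ]
    powers≈c j j<q = mk≈ (subst (V 2) (sym eq) (V-neg (V-*ˡ (Ic j j<q) (V-*-V V[F-1] V[F-1]))))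
      where
      open ≡-Reasoning
      β d u F : ℚ
      β = b (suc j)
      d = c (suc j)
      u = (- β) ^ q₁
      F = (- β) ^ q
      V[F-1] : V 1 (F - 1ℚ)
      V[F-1] = difference (fermat-unit j j<q)
      rearrange : ∀ u d β → β * d * u ≡ - (d * (- β * u))
      rearrange = solve-∀ ringℚ
      u≡ : u ≡ - (d * F)
      u≡ = trans (sym (ℚ.*-identityˡ u)) (trans (cong (_* u) (sym (b*c j j<q))) (rearrange u d β))
      square : ∀ d F → - (d * F) * F - (1ℚ + 1ℚ) * - (d * F) - d ≡ - (d * ((F - 1ℚ) * (F - 1ℚ)))
      square = solve-∀ ringℚ
      eq : ((- β) ^ (q₁ ℕ.+ q)) - (1ℚ + 1ℚ) * u - d ≡ - (d * ((F - 1ℚ) * (F - 1ℚ)))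
      eq = begin
        ((- β) ^ (q₁ ℕ.+ q)) - (1ℚ + 1ℚ) * u - d   ≡⟨ cong (λ s → s - (1ℚ + 1ℚ) * u - d) (^-+ (- β) q₁ q) ⟩
        u * F - (1ℚ + 1ℚ) * u - d                  ≡⟨ cong (λ s → s * F - (1ℚ + 1ℚ) * s - d) u≡ ⟩
        - (d * F) * F - (1ℚ + 1ℚ) * - (d * F) - d  ≡⟨ square d F ⟩
        - (d * ((F - 1ℚ) * (F - 1ℚ)))              ∎

    -- The half sum vanishes modulo p, so Σ c_j² over h < j ≤ r may be extended to all j ≤ r, where
    -- `Bpoly[q₁]≈` recognises it.
    combinedSum-high-Bpoly : ∀ r → r ≤ q → h < r → combinedSum (b r) ≈ π * Bpoly q₁ (- b r) [ 2 ]
    combinedSum-high-Bpoly r r≤q h<r = begin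
      combinedSum (b r)                                    ≡⟨ cong (λ n → combinedSum (b n)) h+k≡r ⟨
      combinedSum (b (h ℕ.+ k))                            ≈⟨ combinedSum-high k (subst (_≤ q) (sym h+k≡r) r≤q) ⟩
      (1ℚ + 1ℚ) * (π * (sum1 (h ℕ.+ k) cc - sum1 h cc))    ≡⟨ cong (λ n → (1ℚ + 1ℚ) * (π * (sum1 n cc - sum1 h cc))) h+k≡r ⟩
      (1ℚ + 1ℚ) * (π * (sum1 r cc - sum1 h cc))            ≈⟨ ≈-*ˡ (Int-ι 2) (≈-scale V-π (≈-- (≈-refl {x = sum1 r cc}) (V⇒≈0 V-Σcc[h]))) ⟩
      (1ℚ + 1ℚ) * (π * (sum1 r cc - 0ℚ))                   ≡⟨ rearrange π (sum1 r cc) ⟩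
      π * ((1ℚ + 1ℚ) * sum1 r cc)                          ≈⟨ ≈-scale V-π (≈-sym (Bpoly[q₁]≈ r r≤q)) ⟩
      π * Bpoly q₁ (- b r)                                 ∎
      where
      open SetoidReasoning (≈-setoid 2)
      k : ℕ
      k = r ∸ h
      h+k≡r : h ℕ.+ k ≡ r
      h+k≡r = ℕ.m+[n∸m]≡n (ℕ.<⇒≤ h<r)
      rearrange : ∀ π s → (1ℚ + 1ℚ) * (π * (s - 0ℚ)) ≡ π * ((1ℚ + 1ℚ) * s)
      rearrange = solve-∀ ringℚ

    -- 2p - 2 = p + (p - 2).
    p∤q+q : ¬ p ∣ q ℕ.+ q
    p∤q+q p∣ = p∤suc {q₂} (s≤s (ℕ.n≤1+n q₁)) (ℕ.∣m+n∣m⇒∣n (subst (p ∣_) (ℕ.+-suc q q₁) p∣) ℕ.∣-refl)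

    -- The two quotients give Σ c_j through `powers≈c`. In the last term b r - r = x, and the ½
    -- cancels the 2 of `Bpoly[q₁]≈`, giving - x Σ c_j².
    alternatingSum-Bpoly : ∀ r → r ≤ q → alternatingSum q (b r) ≈
      - ((Bpoly (q ℕ.+ q) (- b r) - B (q ℕ.+ q)) * recip (q ℕ.+ q))
      + (1ℚ + 1ℚ) * ((Bpoly q (- b r) - B q) * recip q)
      - (b r - ι r) * recip 2 * Bpoly q₁ (- b r) [ 2 ]
    alternatingSum-Bpoly r r≤q = ≈-trans (alternatingSum≈ r r≤q) (≈-sym (begin
      - Q₂ + (1ℚ + 1ℚ) * Q₁ - (b r - ι r) * recip 2 * Bpoly q₁ (- b r)
        ≡⟨ cong (λ s → - Q₂ + (1ℚ + 1ℚ) * Q₁ - s * recip 2 * Bpoly q₁ (- b r)) (cancel x (ι r)) ⟩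
      - Q₂ + (1ℚ + 1ℚ) * Q₁ - x * recip 2 * Bpoly q₁ (- b r)
        ≈⟨ ≈-- (≈-+ (≈-neg (Bpoly-quotient≈ (q₁ ℕ.+ q) r p∤q+q (V-Bpoly[q+q] V[-x])))
                    (≈-*ˡ (Int-ι 2) (Bpoly-quotient≈ q₁ r (p∤suc ℕ.≤-refl) (V-Bpoly[q] V[-x]))))
               (≈-scale (V-*ʳ Vx Int-½) (Bpoly[q₁]≈ r r≤q)) ⟩
      - - Σ₂ + (1ℚ + 1ℚ) * - Σ₁ - x * recip 2 * ((1ℚ + 1ℚ) * sum1 r cc)
        ≡⟨ regroup Σ₂ Σ₁ x (recip 2) (sum1 r cc) ⟩
      (Σ₂ + (- (1ℚ + 1ℚ)) * Σ₁) - x * ((recip 2 * (1ℚ + 1ℚ)) * sum1 r cc)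
        ≡⟨ cong₂ (λ s u → (Σ₂ + s) - x * u) (sym (sum1-*ˡ r (- (1ℚ + 1ℚ)) (λ j → (- b j) ^ q₁))) (ℚ.*-identityˡ (sum1 r cc)) ⟩
      (Σ₂ + sum1 r (λ j → (- (1ℚ + 1ℚ)) * ((- b j) ^ q₁))) - x * sum1 r cc
        ≡⟨ cong (λ s → s - x * sum1 r cc) (sum1-+ r (λ j → (- b j) ^ (q₁ ℕ.+ q)) (λ j → (- (1ℚ + 1ℚ)) * ((- b j) ^ q₁))) ⟨
      sum1 r (λ j → ((- b j) ^ (q₁ ℕ.+ q)) + (- (1ℚ + 1ℚ)) * ((- b j) ^ q₁)) - x * sum1 r cc
        ≈⟨ ≈-- (sum1-≈ r (λ j j<r → ≈-trans (≈-reflexive (minus ((- b (suc j)) ^ (q₁ ℕ.+ q)) ((- b (suc j)) ^ q₁))) (powers≈c j (ℕ.≤-trans j<r r≤q))))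
               (≈-refl {x = x * sum1 r cc}) ⟩
      sum1 r c - x * sum1 r cc ∎))
      where
      open SetoidReasoning (≈-setoid 2)
      Q₂ Q₁ Σ₂ Σ₁ : ℚ
      Q₂ = (Bpoly (q ℕ.+ q) (- b r) - B (q ℕ.+ q)) * recip (q ℕ.+ q)
      Q₁ = (Bpoly q (- b r) - B q) * recip q
      Σ₂ = sum1 r (λ j → (- b j) ^ (q₁ ℕ.+ q))
      Σ₁ = sum1 r (λ j → (- b j) ^ q₁)
      cancel : ∀ x n → x + n - n ≡ x
      cancel = solve-∀ ringℚ
      regroup : ∀ s s′ x h u → - - s + (1ℚ + 1ℚ) * - s′ - x * h * ((1ℚ + 1ℚ) * u) ≡ (s + (- (1ℚ + 1ℚ)) * s′) - x * ((h * (1ℚ + 1ℚ)) * u)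
      regroup = solve-∀ ringℚ
      minus : ∀ s u → s + (- (1ℚ + 1ℚ)) * u ≡ s - (1ℚ + 1ℚ) * u
      minus = solve-∀ ringℚ

-- From the parametrised form to the theorem

2∤p : ∀ {p} → Prime p → 2 < p → ¬ 2 ∣ p
2∤p p-prime 2<p 2∣p = [ (λ ()) , (λ 2≡p → ℕ.<⇒≢ 2<p 2≡p) ]′ (prime⇒irreducible p-prime 2∣p)

even-or-odd : ∀ n → (∃ λ k → n ≡ k ℕ.+ k) ⊎ (∃ λ k → n ≡ suc (k ℕ.+ k))
even-or-odd zero    = inj₁ (0 , refl)
even-or-odd (suc n) = [ (λ (k , e) → inj₂ (k , cong suc e))
                      , (λ (k , e) → inj₁ (suc k , cong suc (trans e (sym (ℕ.+-suc k k))))) ]′ (even-or-odd n)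

k+k≡k*2 : ∀ k → k ℕ.+ k ≡ k ℕ.* 2
k+k≡k*2 k = trans (cong (k ℕ.+_) (sym (ℕ.+-identityʳ k))) (ℕ.*-comm 2 k)

-- The conclusion with (p - 1)/2 and 2p - 2 abstracted to h and n, so that the arithmetic
-- identifying them can be substituted afterwards.
Claim : (p h n : ℕ) (a : ℚ) (r : ℕ) → Set
Claim p h n a r =
  ((r ≤ h → Cong p 2 T 0ℚ) × (r > h → Cong p 2 T (ι p * Bpoly (p ∸ 2) (- a))))
  × Cong p 2 S
      ((- ((Bpoly n (- a) - B n) * recip n))
       + ι 2 * ((Bpoly (p ∸ 1) (- a) - B (p ∸ 1)) * recip (p ∸ 1))
       - ((a - ι r) * ((+ 1) / 2)) * Bpoly (p ∸ 2) (- a))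
  where
  S T : ℚ
  S = alternatingSum (p ∸ 1) a
  T = productSum h a + ι 2 * S

claim : ∀ q₂ m h → q₂ ≡ suc m ℕ.+ suc m → suc (suc q₂) ≡ h ℕ.+ h → let p = suc (suc (suc q₂)) in
  Prime p → ∀ a r → r < p → Cong p 1 a (ι r) → Claim p h (suc (suc q₂) ℕ.+ suc (suc q₂)) a r
claim q₂ m h q₂≡ q≡h+h p-prime a r (s≤s r≤q) (t , t-integral , a-r≡) =
  subst (λ a → Claim p h (q ℕ.+ q) a r) (sym a≡b)
    ( ( (λ r≤h → ≈⇒Cong (combinedSum-low r r≤h))
      , (λ h<r → ≈⇒Cong (combinedSum-high-Bpoly r r≤q h<r)))
    , ≈⇒Cong (alternatingSum-Bpoly r r≤q))
  where
  open Supercongruence q₂ m h q₂≡ q≡h+h p-prime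
  -- The witness t of a ≡ r, with a - r = p t, is the parameter of the descent.
  open Sums t (mkInt t-integral)
  ≈⇒Cong : ∀ {x y n} → x ≈ y [ n ] → Cong p n x y
  ≈⇒Cong (mk≈ (mkV z Iz eq)) = z , p∤↧ Iz , eq
  restore : ∀ a r → a ≡ a - r + r
  restore = solve-∀ ringℚ
  a≡b : a ≡ b r
  a≡b = trans (restore a (ι r)) (cong (_+ ι r) (trans a-r≡ (cong (_* t) p^1≡π)))

theorem2p1 : (p : ℕ) → Prime p → 3 < p → (a : ℚ) → InZp p a → ¬ Cong p 1 a 0ℚ →
    (r : ℕ) → r < p → Cong p 1 a (ℕ→ℚ r) →
    let h = (p ∸ 1) ℕ./ 2
        S = sum1 (p ∸ 1) (λ k → ((- 1ℚ) ^ (k ∸ 1)) * recip k * binom a k)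
        T = sum1 h (λ k → binom a k * binom (- 1ℚ - a) k * recip k) + ℕ→ℚ 2 * S
    in ((r ≤ h → Cong p 2 T 0ℚ)
        × (r > h → Cong p 2 T (ℕ→ℚ p * Bpoly (p ∸ 2) (- a))))
       × Cong p 2 S
           ((- ((Bpoly (2 ℕ.* p ∸ 2) (- a) - B (2 ℕ.* p ∸ 2)) * recip (2 ℕ.* p ∸ 2)))
            + ℕ→ℚ 2 * ((Bpoly (p ∸ 1) (- a) - B (p ∸ 1)) * recip (p ∸ 1))
            - ((a - ℕ→ℚ r) * ((+ 1) / 2)) * Bpoly (p ∸ 2) (- a))
theorem2p1 p p-prime 3<p a _ _ r r<p a≡r = [ even , odd ]′ (even-or-odd p)
  where
  Goal : ℕ → Set
  Goal p = Claim p ((p ∸ 1) ℕ./ 2) (2 ℕ.* p ∸ 2) a r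
  even : (∃ λ k → p ≡ k ℕ.+ k) → Goal p
  even (k , p≡) = contradiction (divides k (trans p≡ (k+k≡k*2 k))) (2∤p p-prime (ℕ.<⇒≤ 3<p))
  from-odd : ∀ k p → p ≡ suc (k ℕ.+ k) → Prime p → 3 < p → r < p → Cong p 1 a (ι r) → Goal p
  -- The values k = 0 and k = 1 mean p = 1 and p = 3, excluded by 3 < p; otherwise k = h = m + 2 and
  -- p = 2m + 5.
  from-odd zero          _ refl _       (s≤s ())
  from-odd (suc zero)    _ refl _       (s≤s (s≤s (s≤s ())))
  from-odd (suc (suc m)) _ refl p-prime _ r<p a≡r =
    subst₂ (λ h n → Claim (suc (suc (suc q₂))) h n a r) (sym h≡) (sym n≡)
      (claim q₂ m h q₂≡ refl p-prime a r r<p a≡r)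
    where
    h q₂ : ℕ
    h  = suc (suc m)
    q₂ = m ℕ.+ h
    q₂≡ : q₂ ≡ suc m ℕ.+ suc m
    q₂≡ = ℕ.+-suc m (suc m)
    h≡ : (h ℕ.+ h) ℕ./ 2 ≡ h
    h≡ = trans (cong (ℕ._/ 2) (k+k≡k*2 h)) (ℕ.m*n/n≡m h 2)
    n≡ : 2 ℕ.* suc (h ℕ.+ h) ∸ 2 ≡ h ℕ.+ h ℕ.+ (h ℕ.+ h)
    n≡ = trans (cong (λ s → suc (h ℕ.+ h) ℕ.+ s ∸ 2) (ℕ.+-identityʳ (suc (h ℕ.+ h)))) (cong (_∸ 1) (ℕ.+-suc (h ℕ.+ h) (h ℕ.+ h)))
  odd : (∃ λ k → p ≡ suc (k ℕ.+ k)) → Goal p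
  odd (k , p≡) = from-odd k p p≡ p-prime 3<p r<p a≡r
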